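{- Let $T$ be a complete first-order theory with monster model $\bar M$ and let $M$ be a small elementary submodel of $\bar M$. Suppose that $(\mathfrak p(x),\phi_{\mathfrak p}(x))$ and $(\mathfrak q(x),\phi_{\mathfrak q}(x))$ are $M$-invariant pairs which are strongly regular, and that $\mathfrak p$ and $\mathfrak q$ are generically stable. Then the following conditions are all equivalent: (1) $\mathfrak p$ and $\mathfrak q$ are orthogonal; (2) $\mathfrak p\upharpoonright M$ and $\mathfrak q\upharpoonright M$ are weakly orthogonal; (3) for some small set $C\supseteq M$, $\mathfrak p\upharpoonright C$ and $\mathfrak q\upharpoonright C$ are weakly orthogonal.
   Context: $T$ is a complete first-order theory with monster model $\bar M$; "small" means of cardinality less than the saturation of $\bar M$. A global type is a complete type over $\bar M$; $\mathfrak p\upharpoonright A$ is the restriction of $\mathfrak p$ to $A$. For small $A$, $\mathfrak p(x)$ is $A$-invariant if for all $\bar b_1\equiv\bar b_2\,(A)$ and all formulas $\phi(x;\bar y)$ over $A$: $\phi(x,\bar b_1)\in\mathfrak p$ iff $\phi(x,\bar b_2)\in\mathfrak p$. Morley sequence: $(a_i\mid i<\alpha)$ is a Morley sequence in $\mathfrak p$ over $A$ if $a_i\models\mathfrak p\upharpoonright Aa_{<i}$ for all $i<\alpha$. Generic stability: a non-algebraic global type $\mathfrak p$ is generically stable if for some small $A$ it is $A$-invariant and, for every infinite $\alpha$ and every Morley sequence $(a_i\mid i<\alpha)$ in $\mathfrak p$ over $A$, for every formula $\phi(x)$ with parameters from $\bar M$ the set $\{i\mid\ \models\phi(a_i)\}$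 is finite or co-finite. Strong regularity (for types in a single variable, possibly of a sort of $\bar M^{eq}$): $(\mathfrak p(x),\phi(x))$ is an $A$-invariant pair if $\mathfrak p$ is $A$-invariant and $\phi(x)\in\mathfrak p\upharpoonright A$. $(\mathfrak p,\phi)$ is strongly regular if for some small $A$ it is an $A$-invariant pair and for all small $B\supseteq A$ and all $a$ satisfying $\phi(x)$: either $a\models\mathfrak p\upharpoonright B$ or $\mathfrak p\upharpoonright B\vdash\mathfrak p\upharpoonright Ba$. Orthogonality: complete types $p,q$ over the same domain are weakly orthogonal if $p(x)\cup q(y)$ (disjoint variables) determines a complete type over that domain. Global types are orthogonal if they are weakly orthogonal as types over $\bar M$. -}

module Defs where

open import Level using (Level; suc)
open import Data.Empty.Polymorphic using (⊥)
open import Data.Unit.Polymorphic using (⊤)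
open import Data.List.Base using (List; []; _∷_; [_]; _++_; map)
open import Data.List.Membership.Propositional using (_∈_)
open import Data.List.Relation.Unary.All as All using (All; []; _∷_)
import Data.List.Relation.Unary.All.Properties as AllP
open import Data.List.Relation.Unary.Any using (Any)
open import Data.Product.Base using (Σ; Σ-syntax; ∃-syntax; _×_; _,_; proj₁; proj₂)
open import Data.Sum.Base using (_⊎_; inj₁; inj₂)
open import Function.Bundles using (_⇔_; Injection; Inverse)
open import Induction.WellFounded using (WellFounded)
open import Relation.Binary.Bundles using (Setoid)
open import Relation.Binary.PropositionalEquality using (_≡_; refl; setoid)
open import Relation.Binary.Structures using (IsStrictTotalOrder)
import Relation.Binary.Construct.On as On
open import Relation.Nullary using (¬_)
open import Relation.Unary using (Pred; _∪_; _⊆_; ｛_｝)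

------------------------------------------------------------------------
-- Ordinals, cardinals, finiteness

record Ordinal (ℓ : Level) : Set (suc ℓ) where
  field
    Idx                : Set ℓ
    _<_                : Idx → Idx → Set ℓ
    isStrictTotalOrder : IsStrictTotalOrder _≡_ _<_
    wellFounded        : WellFounded _<_

  Below : Idx → Setoid ℓ ℓ
  Below α = On.setoid {B = Σ[ i ∈ Idx ] (i < α)} (setoid Idx) proj₁

-- A cardinal is an initial ordinal.
record Cardinal (ℓ : Level) : Set (suc ℓ) where
  field
    ordinal : Ordinal ℓ
  open Ordinal ordinal public
  field
    initial : ∀ α → ¬ Injection (setoid Idx) (Below α)

-- |S| < κ, where |S| counts elements of S up to its equality.
_≺_ : {ℓ : Level} → Setoid ℓ ℓ → Cardinal ℓ → Set ℓ
S ≺ κ = ∃[ α ] Injection S (Cardinal.Below κ α)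

Finite : {ℓ : Level} (S : Setoid ℓ ℓ) → Pred (Setoid.Carrier S) ℓ → Set ℓ
Finite S P = Σ[ xs ∈ List Carrier ] (∀ x → P x → Any (x ≈_) xs)
  where open Setoid S

------------------------------------------------------------------------
-- First-order logic.  Languages are many-sorted, and a sort is
-- interpreted by a setoid whose equality interprets the equality symbol.
-- Thus T^eq and its models, whose imaginary sorts are quotients by
-- ∅-definable equivalence relations, are again of this form, and a single
-- variable of arbitrary sort covers variables of a sort of M̄^eq.

record Language (ℓ : Level) : Set (suc ℓ) where
  field
    Sort : Set ℓ
    Fun  : List Sort → Sort → Set ℓ
    Rel  : List Sort → Set ℓ

module _ {ℓ : Level} (L : Language ℓ) where
  open Language L

  data Term (Γ : List Sort) : Sort → Set ℓ where
    var : ∀ {s} → s ∈ Γ → Term Γ s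
    fun : ∀ {ar s} → Fun ar s → All (Term Γ) ar → Term Γ s

  -- The remaining connectives and ∃ are the usual classical abbreviations.
  data Formula (Γ : List Sort) : Set ℓ where
    eq   : ∀ {s} → Term Γ s → Term Γ s → Formula Γ
    rel  : ∀ {ar} → Rel ar → All (Term Γ) ar → Formula Γ
    bot  : Formula Γ
    _⇒_  : Formula Γ → Formula Γ → Formula Γ
    all′ : ∀ s → Formula (s ∷ Γ) → Formula Γ

  Theory : Set (suc ℓ)
  Theory = Pred (Formula []) ℓ

neg : {ℓ : Level} {L : Language ℓ} {Γ : List (Language.Sort L)} →
      Formula L Γ → Formula L Γ
neg φ = φ ⇒ bot

TupleEq : {ℓ : Level} {I : Set ℓ} (D : I → Setoid ℓ ℓ) {is : List I} →
          (xs ys : All (λ i → Setoid.Carrier (D i)) is) → Set ℓ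
TupleEq D []                 []       = ⊤
TupleEq D {is = i ∷ _} (x ∷ xs) (y ∷ ys) = Setoid._≈_ (D i) x y × TupleEq D xs ys

record Structure {ℓ : Level} (L : Language ℓ) : Set (suc ℓ) where
  open Language L
  field
    Dom : Sort → Setoid ℓ ℓ

  ∣_∣ : Sort → Set ℓ
  ∣ s ∣ = Setoid.Carrier (Dom s)

  _≈_ : ∀ {s} → ∣ s ∣ → ∣ s ∣ → Set ℓ
  _≈_ {s} = Setoid._≈_ (Dom s)

  Tuple : List Sort → Set ℓ
  Tuple = All ∣_∣

  field
    inhabited : ∀ s → ∣ s ∣
    funI      : ∀ {ar s} → Fun ar s → Tuple ar → ∣ s ∣
    relI      : ∀ {ar} → Rel ar → Tuple ar → Set ℓ
    funI-cong : ∀ {ar s} (f : Fun ar s) {xs ys : Tuple ar} →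
                TupleEq Dom xs ys → funI f xs ≈ funI f ys
    relI-resp : ∀ {ar} (R : Rel ar) {xs ys : Tuple ar} →
                TupleEq Dom xs ys → relI R xs → relI R ys

module Semantics {ℓ : Level} {L : Language ℓ} (M : Structure L) where
  open Language L
  open Structure M

  mutual
    ⟦_⟧ : ∀ {Γ s} → Term L Γ s → Tuple Γ → ∣ s ∣
    ⟦ var x ⟧    ρ = All.lookup ρ x
    ⟦ fun f ts ⟧ ρ = funI f (⟦ ts ⟧* ρ)

    ⟦_⟧* : ∀ {Γ ar} → All (Term L Γ) ar → Tuple Γ → Tuple ar
    ⟦ [] ⟧*     ρ = []
    ⟦ t ∷ ts ⟧* ρ = ⟦ t ⟧ ρ ∷ ⟦ ts ⟧* ρ

  Sat : ∀ {Γ} → Formula L Γ → Tuple Γ → Set ℓ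
  Sat (eq t u)   ρ = ⟦ t ⟧ ρ ≈ ⟦ u ⟧ ρ
  Sat (rel R ts) ρ = relI R (⟦ ts ⟧* ρ)
  Sat bot        ρ = ⊥
  Sat (φ ⇒ ψ)    ρ = Sat φ ρ → Sat ψ ρ
  Sat (all′ s φ) ρ = ∀ (a : ∣ s ∣) → Sat φ (a ∷ ρ)

module _ {ℓ : Level} {L : Language ℓ} where

  Models : Structure L → Theory L → Set ℓ
  Models M T = ∀ σ → T σ → Semantics.Sat M σ []

  _⊨ᵀ_ : Theory L → Formula L [] → Set (suc ℓ)
  T ⊨ᵀ σ = (M : Structure L) → Models M T → Semantics.Sat M σ []

  CompleteTheory : Theory L → Set (suc ℓ)
  CompleteTheory T = (Σ[ M ∈ Structure L ] Models M T)
                   × (∀ σ → (T ⊨ᵀ σ) ⊎ (T ⊨ᵀ neg σ))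

------------------------------------------------------------------------
-- Parameters and definable sets in a fixed structure

module InStructure {ℓ : Level} {L : Language ℓ} (M̄ : Structure L) where
  open Language L
  open Structure M̄
  open Semantics M̄

  Element : Set ℓ
  Element = Σ Sort ∣_∣

  data _≋_ : Element → Element → Set ℓ where
    same : ∀ {s} {a b : ∣ s ∣} → a ≈ b → (s , a) ≋ (s , b)

  elementSetoid : Setoid ℓ ℓ
  elementSetoid = record
    { Carrier       = Element
    ; _≈_           = _≋_
    ; isEquivalence = record
      { refl  = λ { {s , a} → same (Setoid.refl (Dom s)) }
      ; sym   = λ { {s , a} (same e) → same (Setoid.sym (Dom s) e) }
      ; trans = λ { {s , a} (same e) (same f) → same (Setoid.trans (Dom s) e f) }
      }
    }

  -- A parameter set need not be closed under ≈: it stands for the set of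
  -- classes of its members.
  Params : Set (suc ℓ)
  Params = Pred Element ℓ

  full : Params
  full _ = ⊤

  Small : Cardinal ℓ → Params → Set ℓ
  Small κ A = On.setoid {B = Σ Element A} elementSetoid proj₁ ≺ κ

  _∈*_ : ∀ {Γ} → Tuple Γ → Params → Set ℓ
  _∈*_ {Γ} c A = ∀ {s} (i : s ∈ Γ) → A (s , All.lookup c i)

  -- A formula in the variables Γ with parameters from M̄: a formula without
  -- parameters whose additional variables Δ are filled by elements of M̄.
  record PFormula (Γ : List Sort) : Set ℓ where
    constructor _⟨_⟩
    field
      {Δ}     : List Sort
      formula : Formula L (Γ ++ Δ)
      params  : Tuple Δ

  not : ∀ {Γ} → PFormula Γ → PFormula Γ
  not (φ ⟨ c ⟩) = neg φ ⟨ c ⟩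

  _over_ : ∀ {Γ} → PFormula Γ → Params → Set ℓ
  φ over A = PFormula.params φ ∈* A

  _⊨_ : ∀ {Γ} → Tuple Γ → PFormula Γ → Set ℓ
  ρ ⊨ (φ ⟨ c ⟩) = Sat φ (AllP.++⁺ ρ c)

  -- φ(x, b), for φ(x; ȳ) with x of sort s and ȳ of sorts Γ.
  plug : ∀ {s Γ} → PFormula (s ∷ Γ) → Tuple Γ → PFormula [ s ]
  plug (φ ⟨ c ⟩) b = φ ⟨ AllP.++⁺ b c ⟩

  FinitelySatisfiable : ∀ {Γ} → Pred (PFormula Γ) ℓ → Set ℓ
  FinitelySatisfiable {Γ} P =
    ∀ φs → All P φs → Σ[ a ∈ Tuple Γ ] All (a ⊨_) φs

  -- b₁ ≡ b₂ (A)
  SameType : Params → ∀ {Γ} → Tuple Γ → Tuple Γ → Set ℓ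
  SameType A {Γ} b₁ b₂ = ∀ (φ : PFormula Γ) → φ over A → (b₁ ⊨ φ) ⇔ (b₂ ⊨ φ)

  --------------------------------------------------------------------
  -- Elementary submodels

  module _ (A : Params) where

    Closed : Set ℓ
    Closed = (∀ s → Σ[ a ∈ ∣ s ∣ ] A (s , a))
           × (∀ {ar s} (f : Fun ar s) (xs : All (λ t → Σ[ a ∈ ∣ t ∣ ] A (t , a)) ar) →
              A (s , funI f (All.map proj₁ xs)))

    module _ (closed : Closed) where

      private
        SubDom : Sort → Setoid ℓ ℓ
        SubDom s = On.setoid {B = Σ[ a ∈ ∣ s ∣ ] A (s , a)} (Dom s) proj₁

        proj-cong : ∀ {ar} (xs ys : All (λ t → Setoid.Carrier (SubDom t)) ar) →
                    TupleEq SubDom xs ys →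
                    TupleEq Dom (All.map proj₁ xs) (All.map proj₁ ys)
        proj-cong []       []       _       = _
        proj-cong (_ ∷ xs) (_ ∷ ys) (e , es) = e , proj-cong xs ys es

      substructure : Structure L
      substructure = record
        { Dom       = SubDom
        ; inhabited = proj₁ closed
        ; funI      = λ f xs → funI f (All.map proj₁ xs) , proj₂ closed f xs
        ; relI      = λ R xs → relI R (All.map proj₁ xs)
        ; funI-cong = λ f {xs} {ys} e → funI-cong f (proj-cong xs ys e)
        ; relI-resp = λ R {xs} {ys} e → relI-resp R (proj-cong xs ys e)
        }

    ElementarySubmodel : Set ℓ
    ElementarySubmodel =
      Σ[ cl ∈ Closed ]
        (∀ {Γ} (φ : Formula L Γ) (ρ : Structure.Tuple (substructure cl) Γ) →
         Semantics.Sat (substructure cl) φ ρ ⇔ Sat φ (All.map proj₁ ρ))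

  --------------------------------------------------------------------
  -- Monster models

  record Automorphism : Set ℓ where
    field
      bijection : ∀ s → Inverse (Dom s) (Dom s)

    ⟨_⟩ : ∀ {s} → ∣ s ∣ → ∣ s ∣
    ⟨_⟩ {s} = Inverse.to (bijection s)

    field
      on-fun : ∀ {ar s} (f : Fun ar s) (xs : Tuple ar) →
               ⟨ funI f xs ⟩ ≈ funI f (All.map ⟨_⟩ xs)
      on-rel : ∀ {ar} (R : Rel ar) (xs : Tuple ar) →
               relI R xs ⇔ relI R (All.map ⟨_⟩ xs)

  record IsMonster (κ : Cardinal ℓ) : Set (suc ℓ) where
    private module κ = Cardinal κ
    field
      -- |T| < κ; as there are infinitely many formulas, κ is uncountable.
      language-small : setoid (Σ[ Γ ∈ List Sort ] Formula L Γ) ≺ κ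

      saturated : ∀ (A : Params) → Small κ A →
                  ∀ {s} (P : Pred (PFormula [ s ]) ℓ) →
                  (∀ φ → P φ → φ over A) → FinitelySatisfiable P →
                  Σ[ a ∈ ∣ s ∣ ] (∀ φ → P φ → (a ∷ []) ⊨ φ)

      -- Strong κ-homogeneity: tuples of length < κ which have the same
      -- type over ∅ are conjugate.
      homogeneous :
        ∀ α → let I = Setoid.Carrier (κ.Below α) in
        (s : I → Sort) (a b : ∀ i → ∣ s i ∣) →
        (∀ (is : List I) (φ : Formula L (map s is)) →
           Sat φ (AllP.map⁺ (All.universal a is)) ⇔
           Sat φ (AllP.map⁺ (All.universal b is))) →
        Σ[ σ ∈ Automorphism ] (∀ i → Automorphism.⟨_⟩ σ (a i) ≈ b i)

  --------------------------------------------------------------------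
  -- Complete types in a single variable

  record Type (A : Params) (s : Sort) : Set (suc ℓ) where
    field
      _∋_        : PFormula [ s ] → Set ℓ
      ∋⇒over     : ∀ φ → _∋_ φ → φ over A
      consistent : FinitelySatisfiable _∋_
      complete   : ∀ φ → φ over A → _∋_ φ ⊎ _∋_ (not φ)

  open Type using (_∋_)

  GlobalType : Sort → Set (suc ℓ)
  GlobalType = Type full

  _↾_ : ∀ {s} → GlobalType s → (A : Params) → Type A s
  p ↾ A = record
    { _∋_        = λ φ → p ∋ φ × φ over A
    ; ∋⇒over     = λ _ → proj₂
    ; consistent = λ φs h → Type.consistent p φs (All.map proj₁ h)
    ; complete   = λ φ o → split φ o (Type.complete p φ _)
    }
    where
    split : ∀ φ → φ over A → p ∋ φ ⊎ p ∋ not φ →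
            (p ∋ φ × φ over A) ⊎ (p ∋ not φ × not φ over A)
    split φ o (inj₁ h) = inj₁ (h , o)
    split φ o (inj₂ h) = inj₂ (h , o)

  _realises_ : ∀ {A s} → ∣ s ∣ → Type A s → Set ℓ
  a realises p = ∀ φ → p ∋ φ → (a ∷ []) ⊨ φ

  -- p ⊢ r, consequence being modulo the elementary diagram of M̄: each
  -- formula of r is implied in M̄ by finitely many formulas of p.
  _⊢_ : ∀ {A B s} → Type A s → Type B s → Set ℓ
  _⊢_ {s = s} p r = ∀ ψ → r ∋ ψ →
    Σ[ φs ∈ List (PFormula [ s ]) ] All (p ∋_) φs ×
      (∀ (a : ∣ s ∣) → All ((a ∷ []) ⊨_) φs → (a ∷ []) ⊨ ψ)

  -- p(x) ∪ q(y) ⊢ θ(x, y)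
  UnionProves : ∀ {A s t} → Type A s → Type A t → PFormula (s ∷ t ∷ []) → Set ℓ
  UnionProves {s = s} {t} p q θ =
    Σ[ φs ∈ List (PFormula [ s ]) ] Σ[ ψs ∈ List (PFormula [ t ]) ]
      All (p ∋_) φs × All (q ∋_) ψs ×
      (∀ (a : ∣ s ∣) (b : ∣ t ∣) →
         All ((a ∷ []) ⊨_) φs → All ((b ∷ []) ⊨_) ψs → (a ∷ b ∷ []) ⊨ θ)

  WeaklyOrthogonal : ∀ {A s t} → Type A s → Type A t → Set ℓ
  WeaklyOrthogonal {A} {s} {t} p q =
    ∀ (θ : PFormula (s ∷ t ∷ [])) → θ over A →
    UnionProves p q θ ⊎ UnionProves p q (not θ)

  Orthogonal : ∀ {s t} → GlobalType s → GlobalType t → Set ℓ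
  Orthogonal p q = WeaklyOrthogonal p q

  --------------------------------------------------------------------
  -- Invariance, generic stability, strong regularity

  Invariant : ∀ {s} → Params → GlobalType s → Set ℓ
  Invariant {s} A p =
    ∀ {Γ} (b₁ b₂ : Tuple Γ) → SameType A b₁ b₂ →
    ∀ (φ : PFormula (s ∷ Γ)) → φ over A → (p ∋ plug φ b₁) ⇔ (p ∋ plug φ b₂)

  InvariantPair : ∀ {s} → Params → GlobalType s → PFormula [ s ] → Set ℓ
  InvariantPair A p φ = Invariant A p × (p ↾ A) ∋ φ

  NonAlgebraic : ∀ {s} → GlobalType s → Set ℓ
  NonAlgebraic {s} p = ∀ φ → p ∋ φ → ¬ Finite (Dom s) (λ a → (a ∷ []) ⊨ φ)

  module _ {s : Sort} (α : Ordinal ℓ) (a : Ordinal.Idx α → ∣ s ∣) where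
    open Ordinal α

    initialPart : Idx → Params
    initialPart i e = Σ[ j ∈ Idx ] (j < i) × (e ≡ (s , a j))

    Morley : GlobalType s → Params → Set ℓ
    Morley p A = ∀ i → a i realises (p ↾ (A ∪ initialPart i))

  module _ (κ : Cardinal ℓ) where

    GenericallyStable : ∀ {s} → GlobalType s → Set (suc ℓ)
    GenericallyStable {s} p = NonAlgebraic p ×
      Σ[ A ∈ Params ] Small κ A × Invariant A p ×
        (∀ (α : Ordinal ℓ) → let I = setoid (Ordinal.Idx α) in
         ¬ Finite I (λ _ → ⊤) →
         ∀ (a : Ordinal.Idx α → ∣ s ∣) → Morley α a p A →
         ∀ (φ : PFormula [ s ]) →
           Finite I (λ i → (a i ∷ []) ⊨ φ) ⊎ Finite I (λ i → ¬ ((a i ∷ []) ⊨ φ)))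

    StronglyRegular : ∀ {s} → GlobalType s → PFormula [ s ] → Set (suc ℓ)
    StronglyRegular {s} p φ =
      Σ[ A ∈ Params ] Small κ A × InvariantPair A p φ ×
        (∀ (B : Params) → Small κ B → A ⊆ B →
         ∀ (a : ∣ s ∣) → (a ∷ []) ⊨ φ →
           (a realises (p ↾ B)) ⊎ ((p ↾ B) ⊢ (p ↾ (B ∪ ｛ s , a ｝))))

{-# OPTIONS --safe #-}
module Submission where

open import Defs
open import Axiom.ExcludedMiddle using (ExcludedMiddle)
open import Data.Bool.Base using (Bool; true; false)
open import Data.Empty using (⊥-elim)
open import Data.Empty.Polymorphic using (⊥) renaming (⊥-elim to ⊥ₚ-elim)
open import Data.List.Base using (List; []; _∷_; [_]; _++_; concat; length)
open import Data.List.Membership.Propositional using (_∈_)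
open import Data.List.Properties using (length-++)
open import Data.List.Relation.Binary.Pointwise.Base using (Pointwise; []; _∷_)
open import Data.List.Relation.Binary.Sublist.Propositional using ([]; _∷ʳ_; _∷_)
  renaming (_⊆_ to Sublist)
open import Data.List.Relation.Unary.All as All using (All; []; _∷_)
import Data.List.Relation.Unary.All.Properties as AllP
open import Data.List.Relation.Unary.Any using (here; there)
open import Data.Nat.Base as ℕ using (ℕ; zero)
open import Data.Nat.Induction using () renaming (<-wellFounded to ℕ-wellFounded)
import Data.Nat.Properties as ℕₚ
open import Data.Product.Base using (Σ; Σ-syntax; _×_; _,_; proj₁; proj₂)
open import Data.Sum.Base as Sum using (_⊎_; inj₁; inj₂)
open import Data.Unit.Polymorphic using (tt) renaming (⊤ to Unit)
open import Function.Base using (id; _∘_)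
open import Function.Bundles using (Equivalence; Injection; _⇔_; mk⇔)
open import Induction.WellFounded using (Acc; acc)
open import Level using (Level; suc)
open import Relation.Binary.Bundles using (Setoid)
open import Relation.Binary.Definitions using (Trichotomous; tri<; tri≈; tri>)
open import Relation.Binary.PropositionalEquality
  using (_≡_; _≢_; refl; sym; trans; cong; cong₂; subst; setoid; isEquivalence)
open import Relation.Binary.Structures using (IsStrictTotalOrder)
open import Relation.Binary.Structures.Biased using (isStrictTotalOrderᶜ)
open import Relation.Nullary using (¬_; yes; no)
open import Relation.Unary using (Pred; _⊆_; _∪_; ｛_｝)

-- Classical logic is used on all types, so it also yields choice.  In a Morley
-- sequence in p of type ω + ω no formula φ(x, b) can hold exactly on the first
-- half; by compactness and indiscernibility a Morley list of some length N_φ on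
-- which φ(x, b) holds forces φ(x, b) ∈ p, for every b.  Hence p is definable, even
-- over M by invariance.
--
-- Descent to M: the parameters of formulas of p and q which together decide a
-- formula over M can be replaced by elements of M, as p and q are definable over M
-- and M is an elementary submodel.
--
-- Ascent from M: let a ⊨ p ↾ N and b ⊨ q ↾ N be dependent over N ⊇ M.  Definability
-- yields c ∈ M and b′ ⊨ φq such that a depends on b′ over M, via a formula in c.  By
-- weak orthogonality over M, b′ does not realise q ↾ M, so b ⊨ q ↾ N b′ by strong
-- regularity of q.  Conjugating a over N b′ along independent copies of b, strong
-- regularity of p and the symmetry of its independence relation give Morley lists
-- of any length on which a formula W(x, b′) ∉ p holds, which is absurd.

-- The ascent therefore works over a small `N` containing `M`, these sets and the parameters of the
-- formula to be decided. Over `M` there remain the definability of p and the assumed weak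
-- orthogonality. This is enough: an element that fails to realise `q ↾ M` also fails to realise
-- `q ↾ N`, and there regularity applies. The length ω + ω matters because a formula that holds on
-- just an initial segment of a sequence of type ω holds finitely often, which generic stability
-- allows. Only a cut with two infinite sides contradicts it.

-- Coding two copies of an infinite cardinal in itself.

module InfiniteCardinal
  {ℓ : Level} (em : ∀ {a} → ExcludedMiddle a) (κ : Cardinal ℓ)
  (enum : ℕ → Cardinal.Idx κ) (enum-injective : ∀ {m n} → enum m ≡ enum n → m ≡ n)
  where

  open Cardinal κ using (Idx; _<_; isStrictTotalOrder; wellFounded; initial)
  open IsStrictTotalOrder isStrictTotalOrder using (compare)
    renaming (trans to <-trans; irrefl to <-irrefl)

  Least : (Idx → Set ℓ) → Idx → Set ℓ
  Least P x = P x × (∀ y → P y → ¬ (y < x))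

  least : (P : Idx → Set ℓ) → Σ Idx P → Σ Idx (Least P)
  least P (x , Px) = go x Px (wellFounded x)
    where
    go : ∀ x → P x → Acc _<_ x → Σ Idx (Least P)
    go x Px (acc rs) with em {P = Σ[ y ∈ Idx ] P y × y < x}
    ... | yes (y , Py , y<x) = go y Py (rs y<x)
    ... | no none            = x , Px , λ y Py y<x → none (y , Py , y<x)

  least-unique : ∀ {P Q x y} → (∀ z → P z → Q z) → (∀ z → Q z → P z) →
                 Least P x → Least Q y → x ≡ y
  least-unique {x = x} {y} P⇒Q Q⇒P (Px , min-x) (Qy , min-y) with compare x y
  ... | tri< x<y _ _ = ⊥-elim (min-y x (P⇒Q x Px) x<y)
  ... | tri≈ _ x≡y _ = x≡y
  ... | tri> _ _ y<x = ⊥-elim (min-x y (Q⇒P y Qy) y<x)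

  -- A greatest element m would make κ inject below m, by moving m along an
  -- infinite sequence starting at m.
  unbounded : ∀ m → Σ[ y ∈ Idx ] m < y
  unbounded m with em {P = Σ[ y ∈ Idx ] m < y}
  ... | yes above = above
  ... | no ¬above = ⊥-elim (initial m (record
    { to        = λ x → shift x , below x
    ; cong      = cong shift
    ; injective = shift-injective
    }))
    where
    seq : Σ[ g ∈ (ℕ → Idx) ] (∀ {i j} → g i ≡ g j → i ≡ j) × g 0 ≡ m
    seq with em {P = Σ[ k ∈ ℕ ] enum k ≡ m}
    ... | yes (k , p≡) = (λ n → enum (k ℕ.+ n)) , (λ e → ℕₚ.+-cancelˡ-≡ k _ _ (enum-injective e)) ,
                         trans (cong enum (ℕₚ.+-identityʳ k)) p≡
    ... | no m∉enum    = g , inj , refl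
      where
      g : ℕ → Idx
      g zero      = m
      g (ℕ.suc n) = enum n
      inj : ∀ {i j} → g i ≡ g j → i ≡ j
      inj {zero}    {zero}    _ = refl
      inj {zero}    {ℕ.suc j} e = ⊥-elim (m∉enum (j , sym e))
      inj {ℕ.suc i} {zero}    e = ⊥-elim (m∉enum (i , e))
      inj {ℕ.suc i} {ℕ.suc j} e = cong ℕ.suc (enum-injective e)

    g    = proj₁ seq
    inj  = proj₁ (proj₂ seq)
    g0≡m = proj₂ (proj₂ seq)

    -- The graph of the Hilbert hotel map along `g`. Being a relation it can be matched on, so
    -- injectivity does not involve the case distinction that computes `shift`.
    Shifts : Idx → Idx → Set ℓ
    Shifts x y = (Σ[ n ∈ ℕ ] g n ≡ x × g (ℕ.suc n) ≡ y) ⊎ ((∀ n → g n ≢ x) × x ≡ y)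

    shifts : ∀ x → Σ Idx (Shifts x)
    shifts x with em {P = Σ[ n ∈ ℕ ] g n ≡ x}
    ... | yes (n , e) = g (ℕ.suc n) , inj₁ (n , e , refl)
    ... | no none     = x , inj₂ ((λ n e → none (n , e)) , refl)

    shift : Idx → Idx
    shift x = proj₁ (shifts x)

    Shifts-injective : ∀ {x x′ y} → Shifts x y → Shifts x′ y → x ≡ x′
    Shifts-injective (inj₁ (n , refl , e)) (inj₁ (n′ , refl , e′)) =
      cong g (ℕₚ.suc-injective (inj (trans e (sym e′))))
    Shifts-injective (inj₁ (n , _ , e)) (inj₂ (out , refl)) = ⊥-elim (out (ℕ.suc n) e)
    Shifts-injective (inj₂ (out , refl)) (inj₁ (n , _ , e)) = ⊥-elim (out (ℕ.suc n) e)
    Shifts-injective (inj₂ (_ , refl)) (inj₂ (_ , e′)) = sym e′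

    shift-injective : ∀ {x y} → shift x ≡ shift y → x ≡ y
    shift-injective {x} {y} e =
      Shifts-injective (subst (Shifts x) e (proj₂ (shifts x))) (proj₂ (shifts y))

    misses-m : ∀ {x y} → Shifts x y → y ≢ m
    misses-m (inj₁ (n , _ , refl)) e with inj (trans e (sym g0≡m))
    ... | ()
    misses-m (inj₂ (out , refl)) e = out 0 (trans g0≡m (sym e))

    below : ∀ x → shift x < m
    below x with compare (shift x) m
    ... | tri< lt _ _ = lt
    ... | tri≈ _ e _  = ⊥-elim (misses-m (proj₂ (shifts x)) e)
    ... | tri> _ _ gt = ⊥-elim (¬above (shift x , gt))

  succ : Idx → Idx
  succ x = proj₁ (least (x <_) (unbounded x))

  x<succ : ∀ x → x < succ x
  x<succ x = proj₁ (proj₂ (least (x <_) (unbounded x)))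

  succ-min : ∀ {x y} → x < y → ¬ (y < succ x)
  succ-min {x} {y} = proj₂ (proj₂ (least (x <_) (unbounded x))) y

  succ≤ : ∀ {x y z} → x < y → y < z → succ x < z
  succ≤ {x} {y} {z} x<y y<z with compare (succ x) z
  ... | tri< lt _ _ = lt
  ... | tri≈ _ refl _ = ⊥-elim (succ-min x<y y<z)
  ... | tri> _ _ gt = ⊥-elim (succ-min (<-trans x<y y<z) gt)

  succ-injective : ∀ {x y} → succ x ≡ succ y → x ≡ y
  succ-injective {x} {y} e with compare x y
  ... | tri< lt _ _ = ⊥-elim (<-irrefl e (succ≤ lt (x<succ y)))
  ... | tri≈ _ x≡y _ = x≡y
  ... | tri> _ _ gt = ⊥-elim (<-irrefl (sym e) (succ≤ gt (x<succ x)))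

  -- λ + n ↦ λ + 2n, for λ zero or a limit.
  data Double : Idx → Idx → Set ℓ where
    limit : ∀ {x} → (∀ y → x ≢ succ y) → Double x x
    next  : ∀ {x d} → Double x d → Double (succ x) (succ (succ d))

  double-exists : ∀ x → Σ Idx (Double x)
  double-exists x = go x (wellFounded x)
    where
    go : ∀ x → Acc _<_ x → Σ Idx (Double x)
    go x (acc rs) with em {P = Σ[ y ∈ Idx ] x ≡ succ y}
    ... | yes (y , refl) = let d , D = go y (rs (x<succ y)) in succ (succ d) , next D
    ... | no none        = x , limit (λ y e → none (y , e))

  Double-functional : ∀ {x y d e} → Double x d → Double y e → x ≡ y → d ≡ e
  Double-functional (limit _) (limit _) p≡ = p≡
  Double-functional (limit l) (next E)  p≡ = ⊥-elim (l _ p≡)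
  Double-functional (next D)  (limit l) p≡ = ⊥-elim (l _ (sym p≡))
  Double-functional (next D)  (next E)  p≡ =
    cong (succ ∘ succ) (Double-functional D E (succ-injective p≡))

  succ-limit : ∀ {x y} → (∀ z → y ≢ succ z) → x < y → succ x < y
  succ-limit {x} {y} l x<y with compare (succ x) y
  ... | tri< lt _ _ = lt
  ... | tri≈ _ e _  = ⊥-elim (l x (sym e))
  ... | tri> _ _ gt = ⊥-elim (succ-min x<y gt)

  Double-below-limit : ∀ {x y d} → (∀ z → y ≢ succ z) → Double x d → x < y → d < y
  Double-below-limit l (limit _) x<y = x<y
  Double-below-limit l (next {x} D) sx<y =
    succ-limit l (succ-limit l (Double-below-limit l D (<-trans (x<succ x) sx<y)))

  -- The bound is on `succ d` because `succ d` is itself a code: the even and the odd code of `x`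
  -- must both lie below those of `y`.
  Double-mono : ∀ {x y d e} → Double x d → Double y e → x < y → succ d < e
  Double-mono D (limit l) x<y = succ-limit l (Double-below-limit l D x<y)
  Double-mono {x} {d = d} D (next {y} {e} E) x<sy with compare x y
  ... | tri< lt _ _ = <-trans (Double-mono D E lt) (<-trans (x<succ e) (x<succ _))
  ... | tri≈ _ p≡ _ rewrite Double-functional D E p≡ = x<succ _
  ... | tri> _ _ gt = ⊥-elim (succ-min gt x<sy)

  -- An injection of two copies of κ into κ that maps bounded sets to bounded sets.
  pair : Bool → Idx → Idx
  pair false x = proj₁ (double-exists x)
  pair true  x = succ (proj₁ (double-exists x))

  private
    even-mono : ∀ {x y} → x < y → pair true x < pair false y
    even-mono {x} {y} = Double-mono (proj₂ (double-exists x)) (proj₂ (double-exists y))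

  pair-mono : ∀ b c {x y} → x < y → pair b x < pair c y
  pair-mono true  false x<y = even-mono x<y
  pair-mono true  true  x<y = <-trans (even-mono x<y) (x<succ _)
  pair-mono false false x<y = <-trans (x<succ _) (even-mono x<y)
  pair-mono false true  x<y = <-trans (x<succ _) (<-trans (even-mono x<y) (x<succ _))

  pair-injective : ∀ b c {x y} → pair b x ≡ pair c y → b ≡ c × x ≡ y
  pair-injective b c {x} {y} e with compare x y
  ... | tri< lt _ _ = ⊥-elim (<-irrefl e (pair-mono b c lt))
  ... | tri> _ _ gt = ⊥-elim (<-irrefl (sym e) (pair-mono c b gt))
  pair-injective false false e | tri≈ _ p≡ _ = refl , p≡
  pair-injective true  true  e | tri≈ _ p≡ _ = refl , p≡
  pair-injective false true  e | tri≈ _ refl _ = ⊥-elim (<-irrefl e (x<succ _))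
  pair-injective true  false e | tri≈ _ refl _ = ⊥-elim (<-irrefl (sym e) (x<succ _))

  -- `_≺_` asks for an injection below a single index, so the codes of a union must stay bounded.
  -- The even code of the larger of `α` and `β` is a bound, as `pair-mono` puts both codes of every
  -- smaller argument below it.
  pair-bound : ∀ α β → Σ[ γ ∈ Idx ] ∀ b x → (x < α ⊎ x < β) → pair b x < γ
  pair-bound α β with compare α β
  ... | tri< α<β _ _ = pair false β , λ
    { b x (inj₁ x<α) → pair-mono b false (<-trans x<α α<β)
    ; b x (inj₂ x<β) → pair-mono b false x<β }
  ... | tri≈ _ refl _ = pair false α , λ
    { b x (inj₁ x<α) → pair-mono b false x<α
    ; b x (inj₂ x<α) → pair-mono b false x<α }
  ... | tri> _ _ β<α = pair false α , λ
    { b x (inj₁ x<α) → pair-mono b false x<α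
    ; b x (inj₂ x<β) → pair-mono b false (<-trans x<β β<α) }

-- Renaming of variables.

module Renaming {ℓ : Level} (L : Language ℓ) where
  open Language L

  Ren : List Sort → List Sort → Set ℓ
  Ren Γ Θ = ∀ {s} → s ∈ Γ → s ∈ Θ

  lift : ∀ {Γ Θ s} → Ren Γ Θ → Ren (s ∷ Γ) (s ∷ Θ)
  lift f (here e)  = here e
  lift f (there i) = there (f i)

  inl : ∀ {Γ Δ} → Ren Γ (Γ ++ Δ)
  inl (here e)  = here e
  inl (there i) = there (inl i)

  inr : ∀ Γ {Δ} → Ren Δ (Γ ++ Δ)
  inr []      i = i
  inr (_ ∷ Γ) i = there (inr Γ i)

  copair : ∀ {Γ Δ Θ} → Ren Γ Θ → Ren Δ Θ → Ren (Γ ++ Δ) Θ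
  copair {[]}    f g i         = g i
  copair {_ ∷ Γ} f g (here e)  = f (here e)
  copair {_ ∷ Γ} f g (there i) = copair {Γ} (f ∘ there) g i

  mutual
    renTerm : ∀ {Γ Θ s} → Ren Γ Θ → Term L Γ s → Term L Θ s
    renTerm f (var i)    = var (f i)
    renTerm f (fun F ts) = fun F (renTerms f ts)

    renTerms : ∀ {Γ Θ ar} → Ren Γ Θ → All (Term L Γ) ar → All (Term L Θ) ar
    renTerms f []       = []
    renTerms f (t ∷ ts) = renTerm f t ∷ renTerms f ts

  ren : ∀ {Γ Θ} → Ren Γ Θ → Formula L Γ → Formula L Θ
  ren f (eq t u)   = eq (renTerm f t) (renTerm f u)
  ren f (rel R ts) = rel R (renTerms f ts)
  ren f bot        = bot
  ren f (φ ⇒ ψ)    = ren f φ ⇒ ren f ψ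
  ren f (all′ s φ) = all′ s (ren (lift f) φ)

-- Definable predicates and their closure properties.

module Definable
  {ℓ : Level} (em : ∀ {a} → ExcludedMiddle a) {L : Language ℓ} (M̄ : Structure L)
  where

  open Language L
  open Renaming L
  open Structure M̄
  open Semantics M̄
  open InStructure M̄

  byContradiction : ∀ {a} {P : Set a} → ¬ ¬ P → P
  byContradiction {P = P} ¬¬p with em {P = P}
  ... | yes p = p
  ... | no ¬p = ⊥-elim (¬¬p ¬p)

  record Agree {Γ Θ} (f : Ren Γ Θ) (θ : Tuple Θ) (ρ : Tuple Γ) : Set ℓ where
    constructor agree
    field at : ∀ {s} (i : s ∈ Γ) → All.lookup θ (f i) ≡ All.lookup ρ i
  open Agree

  agree-lift : ∀ {Γ Θ s} {f : Ren Γ Θ} {θ ρ} → Agree f θ ρ →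
               (a : ∣ s ∣) → Agree (lift f) (a ∷ θ) (a ∷ ρ)
  at (agree-lift H a) (here refl) = refl
  at (agree-lift H a) (there i)   = at H i

  agree-inl : ∀ {Γ Δ} (ρ : Tuple Γ) (c : Tuple Δ) → Agree inl (AllP.++⁺ ρ c) ρ
  at (agree-inl (a ∷ ρ) c) (here refl) = refl
  at (agree-inl (a ∷ ρ) c) (there i)   = at (agree-inl ρ c) i

  agree-inr : ∀ {Γ Δ} (ρ : Tuple Γ) (c : Tuple Δ) → Agree (inr Γ) (AllP.++⁺ ρ c) c
  at (agree-inr []      c) i = refl
  at (agree-inr (a ∷ ρ) c) i = at (agree-inr ρ c) i

  agree-copair : ∀ {Γ Δ Θ} {f : Ren Γ Θ} {g : Ren Δ Θ} {θ} (ρ : Tuple Γ) (c : Tuple Δ) →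
                 Agree f θ ρ → Agree g θ c → Agree (copair f g) θ (AllP.++⁺ ρ c)
  at (agree-copair []      c F G) i           = at G i
  at (agree-copair (a ∷ ρ) c F G) (here refl) = at F (here refl)
  at (agree-copair (a ∷ ρ) c F G) (there i)   =
    at (agree-copair ρ c (agree (λ j → at F (there j))) G) i

  agree-∘ : ∀ {Γ Δ Θ} {f : Ren Γ Δ} {g : Ren Δ Θ} {θ δ ρ} →
            Agree g θ δ → Agree f δ ρ → Agree (g ∘ f) θ ρ
  at (agree-∘ {f = f} G F) i = trans (at G (f i)) (at F i)

  mutual
    ⟦renTerm⟧ : ∀ {Γ Θ s} {f : Ren Γ Θ} {θ ρ} → Agree f θ ρ →
                (t : Term L Γ s) → ⟦ renTerm f t ⟧ θ ≡ ⟦ t ⟧ ρ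
    ⟦renTerm⟧ H (var i)    = at H i
    ⟦renTerm⟧ H (fun F ts) = cong (funI F) (⟦renTerms⟧ H ts)

    ⟦renTerms⟧ : ∀ {Γ Θ ar} {f : Ren Γ Θ} {θ ρ} → Agree f θ ρ →
                 (ts : All (Term L Γ) ar) → ⟦ renTerms f ts ⟧* θ ≡ ⟦ ts ⟧* ρ
    ⟦renTerms⟧ H []       = refl
    ⟦renTerms⟧ H (t ∷ ts) = cong₂ _∷_ (⟦renTerm⟧ H t) (⟦renTerms⟧ H ts)

  infix 3 _↔_
  _↔_ : Set ℓ → Set ℓ → Set ℓ
  X ↔ Y = (X → Y) × (Y → X)

  Sat-ren : ∀ {Γ Θ} {f : Ren Γ Θ} {θ ρ} → Agree f θ ρ →
            (φ : Formula L Γ) → Sat (ren f φ) θ ↔ Sat φ ρ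
  Sat-ren H (eq t u) rewrite ⟦renTerm⟧ H t | ⟦renTerm⟧ H u = id , id
  Sat-ren H (rel R ts) rewrite ⟦renTerms⟧ H ts = id , id
  Sat-ren H bot = id , id
  Sat-ren H (φ ⇒ ψ) = let φ→ , φ← = Sat-ren H φ ; ψ→ , ψ← = Sat-ren H ψ in
    (λ h x → ψ→ (h (φ← x))) , (λ h x → ψ← (h (φ→ x)))
  Sat-ren H (all′ s φ) =
    (λ h a → proj₁ (Sat-ren (agree-lift H a) φ) (h a)) ,
    (λ h a → proj₂ (Sat-ren (agree-lift H a) φ) (h a))

  ∈*-++ : ∀ {A Γ Δ} {ρ : Tuple Γ} {c : Tuple Δ} → ρ ∈* A → c ∈* A → AllP.++⁺ ρ c ∈* A
  ∈*-++ {ρ = []}    r h i           = h i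
  ∈*-++ {ρ = a ∷ ρ} r h (here refl) = r (here refl)
  ∈*-++ {A} {ρ = a ∷ ρ} r h (there i) = ∈*-++ {A} {ρ = ρ} (λ j → r (there j)) h i

  ∈*-∷ : ∀ {A s Γ} {a : ∣ s ∣} {ρ : Tuple Γ} → A (s , a) → ρ ∈* A → (a ∷ ρ) ∈* A
  ∈*-∷ a∈A ρ∈A (here refl) = a∈A
  ∈*-∷ a∈A ρ∈A (there i)   = ρ∈A i

  -- Arguments below handle semantic predicates and obtain the formulas from the closure lemmas, so
  -- that the bookkeeping of variables and parameters is confined to these.
  record Dfn (A : Params) (Γ : List Sort) (X : Tuple Γ → Set ℓ) : Set ℓ where
    constructor dfn
    field
      definition : PFormula Γ
      over-A     : definition over A
      defines    : ∀ ρ → ρ ⊨ definition ↔ X ρ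

  dfn-over : ∀ {A Γ} (φ : PFormula Γ) → φ over A → Dfn A Γ (_⊨ φ)
  dfn-over φ o = dfn φ o (λ _ → id , id)

  dfn-mono : ∀ {A B Γ X} → A ⊆ B → Dfn A Γ X → Dfn B Γ X
  dfn-mono A⊆B (dfn φ o h) = dfn φ (λ i → A⊆B (o i)) h

  dfn-ext : ∀ {A Γ X Y} → (∀ ρ → X ρ ↔ Y ρ) → Dfn A Γ X → Dfn A Γ Y
  dfn-ext XY (dfn φ o h) =
    dfn φ o λ ρ → proj₁ (XY ρ) ∘ proj₁ (h ρ) , proj₂ (h ρ) ∘ proj₂ (XY ρ)

  dfn-formula : ∀ {A Γ} (φ : Formula L Γ) → Dfn A Γ (Sat φ)
  dfn-formula φ = dfn (ren inl φ ⟨ [] ⟩) (λ ()) λ ρ → Sat-ren (agree-inl ρ []) φ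

  dfn-⊥ : ∀ {A Γ} → Dfn A Γ (λ _ → ⊥)
  dfn-⊥ = dfn-formula bot

  dfn-⇒ : ∀ {A Γ X Y} → Dfn A Γ X → Dfn A Γ Y → Dfn A Γ (λ ρ → X ρ → Y ρ)
  dfn-⇒ {A} {Γ} (dfn (φ ⟨ c ⟩) oφ hφ) (dfn (ψ ⟨ d ⟩) oψ hψ) =
    dfn ((ren f φ ⇒ ren g ψ) ⟨ AllP.++⁺ c d ⟩) (∈*-++ {A} {ρ = c} oφ oψ) λ ρ →
      let φ→ , φ← = Sat-ren (F ρ) φ ; ψ→ , ψ← = Sat-ren (G ρ) ψ
          X→ , X← = hφ ρ ; Y→ , Y← = hψ ρ in
      (λ k x → Y→ (ψ→ (k (φ← (X← x))))) , (λ k x → ψ← (Y← (k (X→ (φ→ x)))))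
    where
    f = copair {Γ} inl (inr Γ ∘ inl)
    g = copair {Γ} inl (inr Γ ∘ inr _)
    F : ∀ ρ → Agree f (AllP.++⁺ ρ (AllP.++⁺ c d)) (AllP.++⁺ ρ c)
    F ρ = agree-copair ρ c (agree-inl ρ _)
            (agree-∘ {g = inr Γ} (agree-inr ρ _) (agree-inl c d))
    G : ∀ ρ → Agree g (AllP.++⁺ ρ (AllP.++⁺ c d)) (AllP.++⁺ ρ d)
    G ρ = agree-copair ρ d (agree-inl ρ _)
            (agree-∘ {g = inr Γ} (agree-inr ρ _) (agree-inr c d))

  dfn-∀ : ∀ {A s Γ X} → Dfn A (s ∷ Γ) X → Dfn A Γ (λ ρ → ∀ a → X (a ∷ ρ))
  dfn-∀ {s = s} (dfn (φ ⟨ c ⟩) o h) =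
    dfn (all′ s φ ⟨ c ⟩) o λ ρ →
      (λ k a → proj₁ (h (a ∷ ρ)) (k a)) , (λ k a → proj₂ (h (a ∷ ρ)) (k a))

  dfn-¬ : ∀ {A Γ X} → Dfn A Γ X → Dfn A Γ (λ ρ → ¬ X ρ)
  dfn-¬ D = dfn-ext (λ ρ → (λ k x → ⊥ₚ-elim (k x)) , (λ k x → ⊥-elim (k x))) (dfn-⇒ D dfn-⊥)

  dfn-× : ∀ {A Γ X Y} → Dfn A Γ X → Dfn A Γ Y → Dfn A Γ (λ ρ → X ρ × Y ρ)
  dfn-× D E = dfn-ext
    (λ ρ → (λ k → byContradiction (λ x → k (λ x₁ → λ y → x (x₁ , y)))) , (λ (x , y) k → k x y))
    (dfn-¬ (dfn-⇒ D (dfn-¬ E)))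

  dfn-⊎ : ∀ {A Γ X Y} → Dfn A Γ X → Dfn A Γ Y → Dfn A Γ (λ ρ → X ρ ⊎ Y ρ)
  dfn-⊎ D E = dfn-ext
    (λ ρ → (λ k → byContradiction (λ n → n (inj₂ (k (n ∘ inj₁))))) ,
           (λ { (inj₁ x) ¬x → ⊥-elim (¬x x) ; (inj₂ y) _ → y }))
    (dfn-⇒ (dfn-¬ D) E)

  dfn-∃ : ∀ {A s Γ X} → Dfn A (s ∷ Γ) X → Dfn A Γ (λ ρ → Σ[ a ∈ ∣ s ∣ ] X (a ∷ ρ))
  dfn-∃ D = dfn-ext
    (λ ρ → (λ k → byContradiction (λ n → k (λ a x → n (a , x)))) , (λ (a , x) k → k a x))
    (dfn-¬ (dfn-∀ (dfn-¬ D)))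

  dfn-All : ∀ {A Γ} {I : Set ℓ} {X : I → Tuple Γ → Set ℓ} → (∀ i → Dfn A Γ (X i)) →
            ∀ is → Dfn A Γ (λ ρ → All (λ i → X i ρ) is)
  dfn-All D []       = dfn-ext (λ _ → (λ _ → []) , (λ _ x → x)) (dfn-⇒ dfn-⊥ dfn-⊥)
  dfn-All D (i ∷ is) = dfn-ext (λ _ → (λ (x , xs) → x ∷ xs) , (λ { (x ∷ xs) → x , xs }))
    (dfn-× (D i) (dfn-All D is))

  renP : ∀ {Γ Θ} → Ren Γ Θ → PFormula Γ → PFormula Θ
  renP f (φ ⟨ c ⟩) = ren (copair (inl ∘ f) (inr _)) φ ⟨ c ⟩

  ⊨-renP : ∀ {Γ Θ} {f : Ren Γ Θ} {θ ρ} → Agree f θ ρ → (φ : PFormula Γ) →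
           θ ⊨ renP f φ ↔ ρ ⊨ φ
  ⊨-renP {f = f} {θ} {ρ} H (φ ⟨ c ⟩) = Sat-ren
    (agree-copair ρ c (agree-∘ {f = f} {g = inl} (agree-inl θ c) H) (agree-inr θ c)) φ

  dfn-ren : ∀ {A Γ Θ X} (f : Ren Γ Θ) (g : Tuple Θ → Tuple Γ) → (∀ θ → Agree f θ (g θ)) →
            Dfn A Γ X → Dfn A Θ (X ∘ g)
  dfn-ren f g H (dfn φ o h) = dfn (renP f φ) o λ θ →
    let φ→ , φ← = ⊨-renP (H θ) φ in
    proj₁ (h (g θ)) ∘ φ→ , φ← ∘ proj₂ (h (g θ))

  dfn-plug-right : ∀ {A Γ Δ X} {d : Tuple Δ} → d ∈* A → Dfn A (Γ ++ Δ) X →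
                   Dfn A Γ (λ ρ → X (AllP.++⁺ ρ d))
  dfn-plug-right {A} {Γ} {Δ} {d = d} d∈A (dfn (φ ⟨ c ⟩) o h) =
    dfn (ren f φ ⟨ AllP.++⁺ d c ⟩) (∈*-++ {A} {ρ = d} d∈A o) λ ρ →
      let φ→ , φ← = Sat-ren (F ρ) φ in
      proj₁ (h (AllP.++⁺ ρ d)) ∘ φ→ , φ← ∘ proj₂ (h (AllP.++⁺ ρ d))
    where
    f₀ = copair {Γ} inl (inr Γ ∘ inl)
    f  = copair {Γ ++ Δ} f₀ (inr Γ ∘ inr Δ)
    F : ∀ ρ → Agree f (AllP.++⁺ ρ (AllP.++⁺ d c)) (AllP.++⁺ (AllP.++⁺ ρ d) c)
    F ρ = agree-copair (AllP.++⁺ ρ d) c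
      (agree-copair ρ d (agree-inl ρ _) (agree-∘ {g = inr Γ} (agree-inr ρ _) (agree-inl d c)))
      (agree-∘ {g = inr Γ} (agree-inr ρ _) (agree-inr d c))

  swap : ∀ {s t Γ} → Tuple (s ∷ t ∷ Γ) → Tuple (t ∷ s ∷ Γ)
  swap (a ∷ b ∷ ρ) = b ∷ a ∷ ρ

  dfn-swap : ∀ {A s t Γ X} → Dfn A (t ∷ s ∷ Γ) X → Dfn A (s ∷ t ∷ Γ) (X ∘ swap)
  dfn-swap {s = s} {t} {Γ} = dfn-ren f swap (λ { (a ∷ b ∷ ρ) → agree λ
    { (here refl) → refl ; (there (here refl)) → refl ; (there (there i)) → refl } })
    where
    f : Ren (t ∷ s ∷ Γ) (s ∷ t ∷ Γ)
    f (here e)          = there (here e)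
    f (there (here e))  = here e
    f (there (there i)) = there (there i)

  dfn-weaken : ∀ {A s Γ X} → Dfn A Γ X → Dfn A (s ∷ Γ) (X ∘ All.tail)
  dfn-weaken = dfn-ren there All.tail (λ { (a ∷ ρ) → agree (λ _ → refl) })

  dfn-plug : ∀ {A s Γ X} {a : ∣ s ∣} → A (s , a) → Dfn A (s ∷ Γ) X → Dfn A Γ (λ ρ → X (a ∷ ρ))
  dfn-plug {A} {s} {Γ} {a = a} a∈A (dfn (φ ⟨ c ⟩) o h) =
    dfn (ren f φ ⟨ a ∷ c ⟩) (∈*-∷ {A} a∈A o) λ ρ →
      let φ→ , φ← = Sat-ren (F ρ) φ in
      proj₁ (h (a ∷ ρ)) ∘ φ→ , φ← ∘ proj₂ (h (a ∷ ρ))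
    where
    f₀ : Ren (s ∷ []) (Γ ++ s ∷ _)
    f₀ i = inr Γ (inl i)
    f₁ : Ren (Γ ++ _) (Γ ++ s ∷ _)
    f₁ = copair {Γ} inl (inr Γ ∘ there)
    f : Ren (s ∷ Γ ++ _) (Γ ++ s ∷ _)
    f = copair {s ∷ []} f₀ f₁
    F : ∀ ρ → Agree f (AllP.++⁺ ρ (a ∷ c)) (a ∷ AllP.++⁺ ρ c)
    F ρ = agree-copair {f = f₀} {g = f₁} (a ∷ []) (AllP.++⁺ ρ c)
            (agree-∘ {f = inl} {g = inr Γ} (agree-inr ρ _) (agree-inl (a ∷ []) c))
            (agree-copair ρ c (agree-inl ρ _)
              (agree-∘ {f = there} {g = inr Γ} {δ = a ∷ c} (agree-inr ρ _) (agree (λ _ → refl))))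

  dfn-plug-tail : ∀ {A s Γ X} {b : Tuple Γ} → b ∈* A → Dfn A (s ∷ Γ) X →
                  Dfn A [ s ] (λ ρ → X (All.head ρ ∷ b))
  dfn-plug-tail {A} {b = b} b∈A (dfn (φ ⟨ c ⟩) o h) =
    dfn (φ ⟨ AllP.++⁺ b c ⟩) (∈*-++ {A} {ρ = b} b∈A o) λ { (a ∷ []) → h (a ∷ b) }

  -- Each parameter in turn is made a variable while the remaining ones are treated; afterwards it
  -- is either put back as a parameter from `A` or identified with the new first variable, which
  -- stands for `b`.
  dfn-unplug : ∀ {A t Γ X} {b : ∣ t ∣} → Dfn (A ∪ ｛ t , b ｝) Γ X →
               Σ[ Y ∈ (Tuple (t ∷ Γ) → Set ℓ) ] Dfn A (t ∷ Γ) Y × (∀ ρ → X ρ ↔ Y (b ∷ ρ))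
  dfn-unplug {A} {t} {b = b} (dfn (φ ⟨ c ⟩) o h) =
    let Y , D , k = go φ c o in
    Y , D , λ ρ → proj₁ (k ρ) ∘ proj₂ (h ρ) , proj₁ (h ρ) ∘ proj₂ (k ρ)
    where
    go : ∀ {Γ Δ} (φ : Formula L (Γ ++ Δ)) (c : Tuple Δ) → c ∈* (A ∪ ｛ t , b ｝) →
         Σ[ Y ∈ (Tuple (t ∷ Γ) → Set ℓ) ]
           Dfn A (t ∷ Γ) Y × (∀ ρ → Sat φ (AllP.++⁺ ρ c) ↔ Y (b ∷ ρ))
    go {Γ} φ [] _ = _ , dfn-formula (ren f φ) , λ ρ → let φ→ , φ← = Sat-ren (F ρ) φ in φ← , φ→
      where
      f = copair {Γ} there (λ ())
      F : ∀ ρ → Agree f (b ∷ ρ) (AllP.++⁺ ρ [])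
      F ρ = agree-copair ρ [] (agree (λ _ → refl)) (agree (λ ()))
    go {Γ} {δ ∷ Δ} φ (c₀ ∷ c) o
      with go {δ ∷ Γ} (ren (copair {Γ} (there ∘ inl) (lift (inr Γ))) φ) c (λ i → o (there i))
    ... | Y , D , k = last (o (here refl))
      where
      f = copair {Γ} (there ∘ inl) (lift {s = δ} (inr Γ {Δ}))
      F : ∀ ρ → Agree f (c₀ ∷ AllP.++⁺ ρ c) (AllP.++⁺ ρ (c₀ ∷ c))
      F ρ = agree-copair ρ (c₀ ∷ c) (agree (at (agree-inl ρ c))) (agree-lift (agree-inr ρ c) c₀)
      K : ∀ ρ → Sat φ (AllP.++⁺ ρ (c₀ ∷ c)) ↔ Y (b ∷ c₀ ∷ ρ)
      K ρ = let φ→ , φ← = Sat-ren (F ρ) φ ; Y→ , Y← = k (c₀ ∷ ρ) in Y→ ∘ φ← , φ→ ∘ Y←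
      last : (A ∪ ｛ t , b ｝) (δ , c₀) →
             Σ[ Y ∈ (Tuple (t ∷ Γ) → Set ℓ) ]
               Dfn A (t ∷ Γ) Y × (∀ ρ → Sat φ (AllP.++⁺ ρ (c₀ ∷ c)) ↔ Y (b ∷ ρ))
      last (inj₁ c₀∈A) = _ , dfn-plug c₀∈A (dfn-swap D) , K
      last (inj₂ refl) = _ , dfn-ren merge (λ { (y ∷ ρ) → y ∷ y ∷ ρ })
          (λ { (y ∷ ρ) → agree λ { (here refl) → refl ; (there (here refl)) → refl
                           ; (there (there i)) → refl } }) D , K
        where
        merge : Ren (t ∷ δ ∷ Γ) (t ∷ Γ)
        merge (here e)          = here e
        merge (there (here e))  = here e
        merge (there (there i)) = there i

-- Equality of types, membership in a global type, realisations.

module Types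
  {ℓ : Level} (em : ∀ {a} → ExcludedMiddle a) {L : Language ℓ} (M̄ : Structure L)
  where

  open Language L
  open Renaming L
  open Structure M̄
  open Semantics M̄
  open InStructure M̄
  open Definable em M̄

  record EqType (A : Params) {Γ : List Sort} (b c : Tuple Γ) : Set ℓ where
    constructor eqType
    field sameType : SameType A b c
  open EqType public

  -- The converse implication is the contrapositive, applied to the negated formula, which has the
  -- same parameters.
  eq-intro : ∀ {A Γ} {b c : Tuple Γ} →
             (∀ φ → φ over A → b ⊨ φ → c ⊨ φ) → EqType A b c
  eq-intro {b = b} {c} h = eqType λ φ o → mk⇔ (h φ o)
    (λ cφ → byContradiction (λ ¬bφ → ⊥ₚ-elim (h (not φ) o (λ bφ → ⊥-elim (¬bφ bφ)) cφ)))

  eq-sym : ∀ {A Γ} {b c : Tuple Γ} → EqType A b c → EqType A c b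
  eq-sym (eqType e) = eqType λ φ o → mk⇔ (Equivalence.from (e φ o)) (Equivalence.to (e φ o))

  eq-dfn : ∀ {A Γ X} {b c : Tuple Γ} → EqType A b c → Dfn A Γ X → X b → X c
  eq-dfn {b = b} {c} (eqType e) (dfn φ o h) x =
    proj₁ (h c) (Equivalence.to (e φ o) (proj₂ (h b) x))

  eq-ren : ∀ {A Γ Θ} {f : Ren Γ Θ} {θ θ′ ρ ρ′} → Agree f θ ρ → Agree f θ′ ρ′ →
           EqType A θ θ′ → EqType A ρ ρ′
  eq-ren {f = f} H H′ (eqType e) = eq-intro λ φ o ρφ →
    proj₁ (⊨-renP H′ φ) (Equivalence.to (e (renP f φ) o) (proj₂ (⊨-renP H φ) ρφ))

  eq-plug-right : ∀ {A B Γ Δ} {b c : Tuple Γ} {d : Tuple Δ} → A ⊆ B → d ∈* B →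
                  EqType B b c → EqType A (AllP.++⁺ b d) (AllP.++⁺ c d)
  eq-plug-right A⊆B d∈B e = eq-intro λ φ o →
    eq-dfn e (dfn-plug-right d∈B (dfn-mono A⊆B (dfn-over φ o)))

  -- For definable X this says that p contains the formula defining X; the
  -- sets X with In p X form a filter.
  In : ∀ {s} → GlobalType s → (∣ s ∣ → Set ℓ) → Set ℓ
  In p X = Σ[ φ ∈ PFormula _ ] Type._∋_ p φ × (∀ a → (a ∷ []) ⊨ φ → X a)

  Dfn₁ : Params → (s : Sort) → (∣ s ∣ → Set ℓ) → Set ℓ
  Dfn₁ A s X = Dfn A [ s ] (X ∘ All.head)

  in-mono : ∀ {s} {p : GlobalType s} {X Y : ∣ s ∣ → Set ℓ} →
            (∀ a → X a → Y a) → In p X → In p Y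
  in-mono X⊆Y (φ , p∋φ , h) = φ , p∋φ , λ a → X⊆Y a ∘ h a

  module _ {s : Sort} (p : GlobalType s) where
    open Type p

    in-dec : ∀ {X : ∣ s ∣ → Set ℓ} {A} → Dfn₁ A s X → In p X ⊎ In p (λ a → ¬ X a)
    in-dec (dfn φ _ h) with complete φ (λ _ → tt)
    ... | inj₁ p∋φ  = inj₁ (φ , p∋φ , λ a → proj₁ (h (a ∷ [])))
    ... | inj₂ p∋¬φ = inj₂ (not φ , p∋¬φ , λ a ¬φ x → ⊥ₚ-elim (¬φ (proj₂ (h (a ∷ [])) x)))

    in-All : ∀ (φs : List (PFormula [ s ])) → All _∋_ φs → ∀ {X : ∣ s ∣ → Set ℓ} {A} →
             Dfn₁ A s X → (∀ a → All ((a ∷ []) ⊨_) φs → X a) → In p X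
    in-All φs p∋φs D h with in-dec D
    ... | inj₁ X∈p = X∈p
    ... | inj₂ (ψ , p∋ψ , k) with consistent (ψ ∷ φs) (p∋ψ ∷ p∋φs)
    ...   | (a ∷ []) , ψa ∷ φsa = ⊥-elim (k a ψa (h a φsa))

    in-point : ∀ {X : ∣ s ∣ → Set ℓ} → In p X → Σ ∣ s ∣ X
    in-point (φ , p∋φ , h) with consistent (φ ∷ []) (p∋φ ∷ [])
    ... | (a ∷ []) , φa ∷ [] = a , h a φa

    in-∩ : ∀ {X Y : ∣ s ∣ → Set ℓ} → In p X → In p Y → In p (λ a → X a × Y a)
    in-∩ (φ , p∋φ , h) (ψ , p∋ψ , k) = in-mono {p = p} (λ a (x , y) → h a x , k a y)
      (in-All (φ ∷ ψ ∷ []) (p∋φ ∷ p∋ψ ∷ []) {X = λ a → ((a ∷ []) ⊨ φ) × ((a ∷ []) ⊨ ψ)}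
        (dfn-ext (λ { (a ∷ []) → id , id })
          (dfn-× (dfn-over {full} φ (λ _ → tt)) (dfn-over ψ (λ _ → tt))))
        (λ { a (x ∷ y ∷ []) → x , y }))

    in-disjoint : ∀ {X : ∣ s ∣ → Set ℓ} → In p X → In p (λ a → ¬ X a) → ∀ {b} {Z : Set b} → Z
    in-disjoint i j = let a , x , ¬x = in-point (in-∩ i j) in ⊥-elim (¬x x)

    ∋-in : ∀ {φ} → In p (λ a → (a ∷ []) ⊨ φ) → _∋_ φ
    ∋-in {φ} i with complete φ (λ _ → tt)
    ... | inj₁ p∋φ  = p∋φ
    ... | inj₂ p∋¬φ = in-disjoint i (not φ , p∋¬φ , λ a ¬φ x → ⊥ₚ-elim (¬φ x))

    in-∋ : ∀ {φ} → _∋_ φ → In p (λ a → (a ∷ []) ⊨ φ)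
    in-∋ {φ} p∋φ = φ , p∋φ , λ _ → id

  record _⊩_∣_ {s : Sort} (a : ∣ s ∣) (p : GlobalType s) (B : Params) : Set ℓ where
    constructor real
    field satisfies : a realises (p ↾ B)
  open _⊩_∣_ public

  real-in : ∀ {s} {p : GlobalType s} {B} {a : ∣ s ∣} {X : ∣ s ∣ → Set ℓ} →
            a ⊩ p ∣ B → Dfn₁ B s X → In p X → X a
  real-in {p = p} {a = a} (real r) (dfn φ o h) X∈p = proj₁ (h (a ∷ [])) (r φ
    (∋-in p {φ} (in-mono {p = p} (λ x → proj₂ (h (x ∷ []))) X∈p) , o))

  in-real : ∀ {s} {p : GlobalType s} {B} {a : ∣ s ∣} {X : ∣ s ∣ → Set ℓ} →
            a ⊩ p ∣ B → Dfn₁ B s X → X a → In p X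
  in-real {p = p} r D x with in-dec p D
  ... | inj₁ X∈p  = X∈p
  ... | inj₂ ¬X∈p = ⊥-elim (real-in r (dfn-¬ D) ¬X∈p x)

  real-mono : ∀ {s} {p : GlobalType s} {B C} {a : ∣ s ∣} → B ⊆ C → a ⊩ p ∣ C → a ⊩ p ∣ B
  real-mono B⊆C (real r) = real λ φ (p∋φ , o) → r φ (p∋φ , λ i → B⊆C (o i))

  ¬real : ∀ {s} {p : GlobalType s} {B} {a : ∣ s ∣} {X : ∣ s ∣ → Set ℓ} →
          Dfn₁ B s X → In p (λ x → ¬ X x) → X a → ¬ (a ⊩ p ∣ B)
  ¬real D ¬X∈p x r = real-in r (dfn-¬ D) ¬X∈p x

  eq-realisers : ∀ {s Γ A B} {p : GlobalType s} {a b : ∣ s ∣} {c : Tuple Γ} → A ⊆ B → c ∈* B →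
                 a ⊩ p ∣ B → b ⊩ p ∣ B → EqType A (a ∷ c) (b ∷ c)
  eq-realisers {c = c} A⊆B c∈B ra rb = eq-intro λ φ o acφ →
    let D = dfn-plug-tail {X = _⊨ φ} {b = c} c∈B (dfn-mono A⊆B (dfn-over φ o))
    in real-in rb D (in-real ra D acφ)

  real-eq : ∀ {s B} {p : GlobalType s} {a b : ∣ s ∣} → EqType B (a ∷ []) (b ∷ []) →
            a ⊩ p ∣ B → b ⊩ p ∣ B
  real-eq e ra = real λ φ (p∋φ , o) → eq-dfn e (dfn-over φ o) (satisfies ra φ (p∋φ , o))

  inv-in : ∀ {s A Γ X} {p : GlobalType s} {b c : Tuple Γ} → Invariant A p → EqType A b c →
           Dfn A (s ∷ Γ) X → In p (λ a → X (a ∷ b)) → In p (λ a → X (a ∷ c))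
  inv-in {p = p} {b} {c} inv (eqType e) (dfn φ o h) i =
    in-mono {p = p} (λ a → proj₁ (h (a ∷ c))) (in-∋ p {plug φ c} (Equivalence.to (inv b c e φ o)
      (∋-in p {plug φ b} (in-mono {p = p} (λ a → proj₂ (h (a ∷ b))) i))))

  -- The parameters `d` in `B` are appended to the tuples: if `b` and `c` have the same type over
  -- `B`, then `b d` and `c d` have the same type over `A`.
  inv-mono : ∀ {s A B} {p : GlobalType s} → A ⊆ B → Invariant A p → Invariant B p
  inv-mono {s} {A} {B} {p} A⊆B inv b c e φ@(χ ⟨ d ⟩) o =
    mk⇔ (transport (eqType e)) (transport (eq-sym (eqType e)))
    where
    transport : ∀ {b c} → EqType B b c → Type._∋_ p (plug φ b) → Type._∋_ p (plug φ c)
    transport {b} {c} e h = ∋-in p {plug φ c} (inv-in {p = p} inv (eq-plug-right {d = d} A⊆B o e)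
      (dfn-formula χ) (in-∋ p {plug φ b} h))

  real-intro : ∀ {s} {p : GlobalType s} {B} {a : ∣ s ∣} →
               (∀ {X : ∣ s ∣ → Set ℓ} → Dfn₁ B s X → In p X → X a) → a ⊩ p ∣ B
  real-intro {p = p} h = real λ φ (p∋φ , o) →
    h (dfn-ext (λ { (a ∷ []) → id , id }) (dfn-over φ o)) (in-∋ p {φ} p∋φ)

-- Small sets, saturation, compactness, Tarski-Vaught.

module Saturation
  {ℓ : Level} (em : ∀ {a} → ExcludedMiddle a) {L : Language ℓ} (M̄ : Structure L)
  (κ : Cardinal ℓ) (monster : InStructure.IsMonster M̄ κ)
  where

  open Language L
  open Renaming L
  open Structure M̄
  open Semantics M̄
  open InStructure M̄
  open Definable em M̄
  open Types em M̄
  open Cardinal κ using (Idx; _<_; isStrictTotalOrder)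
  open IsMonster monster

  private
    -- Distinct sentences that exist in every language. Through `language-small` they embed ℕ below
    -- the index `α₀`, so `κ` is infinite and countable sets are small.
    tower : ℕ → Formula L []
    tower zero      = bot
    tower (ℕ.suc n) = bot ⇒ tower n

    tower-injective : ∀ m n → tower m ≡ tower n → m ≡ n
    tower-injective zero      zero      _ = refl
    tower-injective (ℕ.suc m) (ℕ.suc n) e = cong ℕ.suc (tower-injective m n (conclusion e))
      where
      conclusion : ∀ {Γ} {φ ψ χ ω : Formula L Γ} → (φ ⇒ ψ) ≡ (χ ⇒ ω) → ψ ≡ ω
      conclusion refl = refl

    α₀ : Idx
    α₀ = proj₁ language-small

    enum : ℕ → Idx
    enum n = proj₁ (Injection.to (proj₂ language-small) ([] , tower n))

    enum<α₀ : ∀ n → enum n < α₀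
    enum<α₀ n = proj₂ (Injection.to (proj₂ language-small) ([] , tower n))

    enum-injective : ∀ {m n} → enum m ≡ enum n → m ≡ n
    enum-injective {m} {n} e =
      tower-injective m n (sentence (Injection.injective (proj₂ language-small) e))
      where
      sentence : ∀ {φ ψ : Formula L []} →
                 _≡_ {A = Σ[ Γ ∈ List Sort ] Formula L Γ} ([] , φ) ([] , ψ) → φ ≡ ψ
      sentence refl = refl

  open InfiniteCardinal em κ enum enum-injective

  private
    module E = Setoid elementSetoid

  -- A code of `e` must depend neither on the proof of membership nor on the representative of the
  -- class of `e`. The least index related to `e` has both properties, since `R` respects `≋`.
  small-intro : ∀ {A : Params} α (R : Element → Idx → Set ℓ) →
                (∀ e → A e → Σ[ x ∈ Idx ] x < α × R e x) →
                (∀ {e f x} → R e x → R f x → e ≋ f) →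
                (∀ {e f x} → e ≋ f → R e x → R f x) → Small κ A
  small-intro {A} α R total inj cng = α , record
    { to        = λ (e , e∈A) → code e e∈A , code<α e e∈A
    ; cong      = λ {(e , e∈A)} {(f , f∈A)} e≋f → least-unique {P = R e} {R f}
                    (λ _ → cng e≋f) (λ _ → cng (E.sym e≋f))
                    (code-least e e∈A) (code-least f f∈A)
    ; injective = λ {(e , e∈A)} {(f , f∈A)} p≡ → inj
                    (subst (R e) p≡ (proj₁ (code-least e e∈A))) (proj₁ (code-least f f∈A))
    }
    where
    codes : ∀ e → A e → Σ Idx (Least (λ x → x < α × R e x))
    codes e e∈A = least _ (total e e∈A)
    code : ∀ e → A e → Idx
    code e e∈A = proj₁ (codes e e∈A)
    code<α : ∀ e e∈A → code e e∈A < α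
    code<α e e∈A = proj₁ (proj₁ (proj₂ (codes e e∈A)))
    code-least : ∀ e e∈A → Least (R e) (code e e∈A)
    code-least e e∈A = let x , (x<α , r) , min = codes e e∈A in
      r , λ y Ry y<x → min y (IsStrictTotalOrder.trans isStrictTotalOrder y<x x<α , Ry) y<x

  small-mono : ∀ {A B : Params} → A ⊆ B → Small κ B → Small κ A
  small-mono A⊆B (α , ι) = α , record
    { to        = λ (e , e∈A) → Injection.to ι (e , A⊆B e∈A)
    ; cong      = λ {(e , e∈A)} {(f , f∈A)} → Injection.cong ι {e , A⊆B e∈A} {f , A⊆B f∈A}
    ; injective = λ {(e , e∈A)} {(f , f∈A)} → Injection.injective ι {e , A⊆B e∈A} {f , A⊆B f∈A}
    }

  small-∪ : ∀ {A B : Params} → Small κ A → Small κ B → Small κ (A ∪ B)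
  small-∪ {A} {B} (α , ι) (β , υ) = small-intro γ R total inj cng
    where
    γ = proj₁ (pair-bound α β)
    R : Element → Idx → Set ℓ
    R e x = (Σ[ a ∈ Σ Element A ] proj₁ a ≋ e × pair false (proj₁ (Injection.to ι a)) ≡ x)
          ⊎ (Σ[ b ∈ Σ Element B ] proj₁ b ≋ e × pair true (proj₁ (Injection.to υ b)) ≡ x)
    total : ∀ e → (A ∪ B) e → Σ[ x ∈ Idx ] x < γ × R e x
    total e (inj₁ a) = _ , proj₂ (pair-bound α β) false _ (inj₁ (proj₂ (Injection.to ι (e , a)))) ,
                       inj₁ ((e , a) , E.refl {e} , refl)
    total e (inj₂ b) = _ , proj₂ (pair-bound α β) true _ (inj₂ (proj₂ (Injection.to υ (e , b)))) ,
                       inj₂ ((e , b) , E.refl {e} , refl)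
    inj : ∀ {e f x} → R e x → R f x → e ≋ f
    inj (inj₁ (a , a≋e , p)) (inj₁ (a′ , a′≋f , p′)) = E.trans (E.sym a≋e) (E.trans
      (Injection.injective ι {a} {a′} (proj₂ (pair-injective false false (trans p (sym p′))))) a′≋f)
    inj (inj₂ (b , b≋e , p)) (inj₂ (b′ , b′≋f , p′)) = E.trans (E.sym b≋e) (E.trans
      (Injection.injective υ {b} {b′} (proj₂ (pair-injective true true (trans p (sym p′))))) b′≋f)
    inj (inj₁ (_ , _ , p)) (inj₂ (_ , _ , p′)) with pair-injective false true (trans p (sym p′))
    ... | () , _
    inj (inj₂ (_ , _ , p)) (inj₁ (_ , _ , p′)) with pair-injective true false (trans p (sym p′))
    ... | () , _
    cng : ∀ {e f x} → e ≋ f → R e x → R f x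
    cng e≋f (inj₁ (a , a≋e , p)) = inj₁ (a , E.trans a≋e e≋f , p)
    cng e≋f (inj₂ (b , b≋e , p)) = inj₂ (b , E.trans b≋e e≋f , p)

  Range : ∀ {s} → (ℕ → ∣ s ∣) → Params
  Range {s} a e = Σ[ n ∈ ℕ ] e ≡ (s , a n)

  small-Range : ∀ {s} (a : ℕ → ∣ s ∣) → Small κ (Range a)
  small-Range {s} a = small-intro α₀ (λ e x → Σ[ n ∈ ℕ ] (s , a n) ≋ e × enum n ≡ x)
    (λ { e (n , refl) → enum n , enum<α₀ n , n , E.refl , refl })
    (λ { (m , a≋e , refl) (n , b≋f , p) → joined m n (enum-injective p) a≋e b≋f })
    (λ { e≋f (n , a≋e , p) → n , E.trans a≋e e≋f , p })
    where
    joined : ∀ m n → n ≡ m → ∀ {e f} → (s , a m) ≋ e → (s , a n) ≋ f → e ≋ f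
    joined m .m refl a≋e a≋f = E.trans (E.sym a≋e) a≋f

  small-single : ∀ {s} (a : ∣ s ∣) → Small κ ｛ s , a ｝
  small-single a = small-mono (λ e≡ → 0 , sym e≡) (small-Range (λ _ → a))

  Entries : ∀ {Γ} → Tuple Γ → Params
  Entries {Γ} c (s , a) = Σ[ i ∈ s ∈ Γ ] All.lookup c i ≡ a

  entries : ∀ {Γ} {c : Tuple Γ} → c ∈* Entries c
  entries i = i , refl

  small-∪-entries : ∀ {A Γ} (c : Tuple Γ) → Small κ A → Small κ (A ∪ Entries c)
  small-∪-entries []      small = small-mono (λ { (inj₁ x) → x ; (inj₂ (() , _)) }) small
  small-∪-entries (a ∷ c) small = small-mono
    (λ { (inj₁ x) → inj₁ (inj₁ x)
       ; (inj₂ (here refl , refl)) → inj₂ refl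
       ; (inj₂ (there i , e)) → inj₁ (inj₂ (i , e)) })
    (small-∪ (small-∪-entries c small) (small-single a))

  saturation₁ : ∀ {A s} {I : Set ℓ} {X : I → Tuple [ s ] → Set ℓ} → Small κ A →
                (∀ i → Dfn A [ s ] (X i)) →
                (∀ is → Σ[ a ∈ ∣ s ∣ ] All (λ i → X i (a ∷ [])) is) →
                Σ[ a ∈ ∣ s ∣ ] (∀ i → X i (a ∷ []))
  saturation₁ {A} {s} {I} {X} small D fip =
    let a , h = saturated A small P P⇒over fs in
    a , λ i → proj₁ (Dfn.defines (D i) (a ∷ [])) (h (Dfn.definition (D i)) (i , refl))
    where
    P : Pred (PFormula [ s ]) ℓ
    P φ = Σ[ i ∈ I ] Dfn.definition (D i) ≡ φ
    P⇒over : ∀ φ → P φ → φ over A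
    P⇒over _ (i , refl) = Dfn.over-A (D i)
    indices : ∀ {φs} → All P φs → List I
    indices []             = []
    indices ((i , _) ∷ ps) = i ∷ indices ps
    satisfied : ∀ {φs a} (ps : All P φs) → All (λ i → X i (a ∷ [])) (indices ps) →
                All ((a ∷ []) ⊨_) φs
    satisfied []                []       = []
    satisfied {a = a} ((i , refl) ∷ ps) (x ∷ xs) =
      proj₂ (Dfn.defines (D i) (a ∷ [])) x ∷ satisfied ps xs
    fs : FinitelySatisfiable P
    fs φs ps = let a , h = fip (indices ps) in (a ∷ []) , satisfied ps h

  -- Induction on the length of the tuple. The tail is chosen so that every finite conjunction of
  -- the conditions has a solution in the first coordinate; this is finite satisfiability for the
  -- head over `A` and the tail.
  saturation : ∀ {A Γ} {I : Set ℓ} {X : I → Tuple Γ → Set ℓ} → Small κ A →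
               (∀ i → Dfn A Γ (X i)) → (∀ is → Σ[ ρ ∈ Tuple Γ ] All (λ i → X i ρ) is) →
               Σ[ ρ ∈ Tuple Γ ] (∀ i → X i ρ)
  saturation {Γ = []} {X = X} small D fip = [] , λ i → only (fip (i ∷ []))
    where
    only : ∀ {i} → Σ[ ρ ∈ Tuple [] ] All (λ i → X i ρ) (i ∷ []) → X i []
    only ([] , x ∷ []) = x
  saturation {A} {s ∷ Γ} {I} {X} small D fip =
    let a , h = saturation₁ {A = A ∪ Entries ρ} {X = λ i a → X i (All.head a ∷ ρ)}
                  (small-∪-entries ρ small)
                  (λ i → dfn-plug-tail {b = ρ} (λ j → inj₂ (entries {c = ρ} j)) (dfn-mono inj₁ (D i)))
                  ρ-good
    in a ∷ ρ , h
    where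
    tail-fip : (iss : List (List I)) →
               Σ[ ρ ∈ Tuple Γ ] All (λ is → Σ[ a ∈ ∣ s ∣ ] All (λ i → X i (a ∷ ρ)) is) iss
    -- A solution for the union of finitely many finite sets of conditions serves all of them with
    -- the same head.
    tail-fip iss with fip (concat iss)
    ... | a ∷ ρ , h = ρ , All.map (a ,_) (AllP.concat⁻ {xss = iss} h)
    tail : Σ[ ρ ∈ Tuple Γ ] (∀ is → Σ[ a ∈ ∣ s ∣ ] All (λ i → X i (a ∷ ρ)) is)
    tail = saturation small (λ is → dfn-∃ (dfn-All D is)) tail-fip
    ρ = proj₁ tail
    ρ-good = proj₂ tail

  abstract
    compactness : ∀ {A Γ} {I : Set ℓ} {X : I → Tuple Γ → Set ℓ} → Small κ A →
                  (∀ i → Dfn A Γ (X i)) → ¬ (Σ[ ρ ∈ Tuple Γ ] (∀ i → X i ρ)) →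
                  Σ[ is ∈ List I ] (∀ ρ → ¬ All (λ i → X i ρ) is)
    compactness small D none = byContradiction λ n → none (saturation small D
      (λ is → byContradiction (λ m → n (is , λ ρ h → m (ρ , h)))))

  -- b realises over ρ the type that b′ realises over the conjugate ρ′ of ρ.
  transfer₁ : ∀ {A s Γ} {ρ ρ′ : Tuple Γ} → Small κ A → EqType A ρ ρ′ → (b′ : ∣ s ∣) →
              Σ[ b ∈ ∣ s ∣ ] EqType A (b ∷ ρ) (b′ ∷ ρ′)
  transfer₁ {A} {s} {Γ} {ρ} {ρ′} small e b′ =
    let b , h = saturation₁ {I = I} {X = λ (φ , _) b → (All.head b ∷ ρ) ⊨ φ}
                  (small-∪-entries ρ small)
                  (λ (φ , o , _) → dfn-plug-tail {X = _⊨ φ} {b = ρ} (λ j → inj₂ (entries {c = ρ} j))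
                                     (dfn-mono inj₁ (dfn-over φ o)))
                  fip
    in b , eq-sym (eq-intro λ φ o b′φ → h (φ , o , b′φ))
    where
    I : Set ℓ
    I = Σ[ φ ∈ PFormula (s ∷ Γ) ] φ over A × (b′ ∷ ρ′) ⊨ φ
    fip : (is : List I) → Σ[ b ∈ ∣ s ∣ ] All (λ (φ , _) → (b ∷ ρ) ⊨ φ) is
    fip is = eq-dfn (eq-sym e)
      (dfn-∃ {X = λ ρ → All (λ (φ , _) → ρ ⊨ φ) is}
        (dfn-All {X = λ (φ , _) ρ → ρ ⊨ φ} (λ (φ , o , _) → dfn-over φ o) is))
      (b′ , All.universal (λ (_ , _ , h) → h) is)

  abstract
    transfer : ∀ {A Γ Δ} {ρ ρ′ : Tuple Γ} → Small κ A → EqType A ρ ρ′ → (b′ : Tuple Δ) →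
               Σ[ b ∈ Tuple Δ ] EqType A (AllP.++⁺ b ρ) (AllP.++⁺ b′ ρ′)
    transfer small e []       = [] , e
    transfer small e (b′ ∷ c′) =
      let c , e′ = transfer small e c′ ; b , e″ = transfer₁ small e′ b′ in b ∷ c , e″

  abstract
    realiser : ∀ {s B} (p : GlobalType s) → Small κ B → Σ[ a ∈ ∣ s ∣ ] (a ⊩ p ∣ B)
    realiser {s} {B} p small =
      let a , h = saturated B small (Type._∋_ (p ↾ B)) (λ _ → proj₂) (Type.consistent (p ↾ B))
      in a , real h

  -- Compactness is used twice. The type over `A` of a point of `X` implies `X` by invariance, so
  -- some formula over `A` contains the point and lies inside `X`; finitely many such formulas then
  -- cover `X`.
  dfn-invariant : ∀ {A B Γ X} → Small κ A → Small κ B → A ⊆ B → Dfn B Γ X →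
                  (∀ {b c} → EqType A b c → X b → X c) → Dfn A Γ X
  dfn-invariant {A} {B} {Γ} {X} smallA smallB A⊆B D inv = covered
    (compactness {X = Uncovered} smallB
      (λ { (inj₁ _) → D ; (inj₂ (φ , o , _)) → dfn-mono A⊆B (dfn-¬ (dfn-over φ o)) })
      (λ (ρ , h) → let j , ρφ = neighbourhood ρ (h (inj₁ tt)) in h (inj₂ j) ρφ))
    where
    Inside : Set ℓ
    Inside = Σ[ φ ∈ PFormula Γ ] φ over A × (∀ ρ → ρ ⊨ φ → X ρ)

    neighbourhood : ∀ b → X b → Σ[ (φ , _) ∈ Inside ] b ⊨ φ
    neighbourhood b x = (definition , over-A , λ ρ ρψ → byContradiction λ ¬x →
        none ρ (All.map (λ { {inj₁ _} _ → ¬x ; {inj₂ _} h → h }) (proj₁ (defines ρ) ρψ))) ,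
      proj₂ (defines b) (All.universal (λ { (inj₁ _) → λ (z : ⊥ {ℓ}) → z ; (inj₂ (_ , _ , h)) → h }) is)
      where
      I : Set ℓ
      I = Unit {ℓ} ⊎ (Σ[ φ ∈ PFormula Γ ] φ over A × b ⊨ φ)
      -- `Z` has the true formula where `Outside` has the complement of `X`, so that its finite
      -- conjunctions are over `A`.
      Outside Z : I → Tuple Γ → Set ℓ
      Outside (inj₁ _)       ρ = ¬ X ρ
      Outside (inj₂ (φ , _)) ρ = ρ ⊨ φ
      Z (inj₁ _)       ρ = ⊥ {ℓ} → ⊥ {ℓ}
      Z (inj₂ (φ , _)) ρ = ρ ⊨ φ
      compact = compactness {A = B} {X = Outside} smallB
        (λ { (inj₁ _) → dfn-¬ D ; (inj₂ (φ , o , _)) → dfn-mono A⊆B (dfn-over φ o) })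
        (λ (ρ , h) → h (inj₁ tt) (inv (eq-intro λ φ o bφ → h (inj₂ (φ , o , bφ))) x))
      is = proj₁ compact
      none = proj₂ compact
      D∧ : Dfn A Γ (λ ρ → All (λ i → Z i ρ) is)
      D∧ = dfn-All {A} {X = Z}
        (λ { (inj₁ _) → dfn-⇒ dfn-⊥ dfn-⊥ ; (inj₂ (φ , o , _)) → dfn-over φ o }) is
      open Dfn D∧

    Uncovered Z : Unit {ℓ} ⊎ Inside → Tuple Γ → Set ℓ
    Uncovered (inj₁ _)       ρ = X ρ
    Uncovered (inj₂ (φ , _)) ρ = ¬ (ρ ⊨ φ)
    Z (inj₁ _)       ρ = ⊥ {ℓ} → ⊥ {ℓ}
    Z (inj₂ (φ , _)) ρ = ¬ (ρ ⊨ φ)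

    covered : Σ[ is ∈ List (Unit {ℓ} ⊎ Inside) ] (∀ ρ → ¬ All (λ i → Uncovered i ρ) is) → Dfn A Γ X
    covered (is , none) = dfn-ext
      (λ ρ → (λ ¬all → byContradiction λ ¬x → ¬all (All.universal
                (λ { (inj₁ _) → λ (z : ⊥ {ℓ}) → z ; (inj₂ (φ , _ , φ⊆X)) → λ ρφ → ¬x (φ⊆X ρ ρφ) }) is)) ,
             (λ x all → none ρ (All.map (λ { {inj₁ _} _ → x ; {inj₂ _} h → h }) all)))
      (dfn-¬ (dfn-All {X = Z}
        (λ { (inj₁ _) → dfn-⇒ dfn-⊥ dfn-⊥ ; (inj₂ (φ , o , _)) → dfn-¬ (dfn-over φ o) }) is))

  module _ (M : Params) (elementary : ElementarySubmodel M) where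

    private
      closed = proj₁ elementary
      N = substructure M closed
      module N = Structure N

      restrict : ∀ {Γ} (c : Tuple Γ) → c ∈* M → N.Tuple Γ
      restrict []      _   = []
      restrict (a ∷ c) c∈M = (a , c∈M (here refl)) ∷ restrict c (λ i → c∈M (there i))

      map-restrict : ∀ {Γ} (c : Tuple Γ) (c∈M : c ∈* M) → All.map proj₁ (restrict c c∈M) ≡ c
      map-restrict []      _   = refl
      map-restrict (a ∷ c) c∈M = cong (a ∷_) (map-restrict c (λ i → c∈M (there i)))

    tarskiVaught₁ : ∀ {s X} → Dfn M [ s ] X → Σ[ a ∈ ∣ s ∣ ] X (a ∷ []) →
                    Σ[ a ∈ ∣ s ∣ ] M (s , a) × X (a ∷ [])
    tarskiVaught₁ {s} {X} (dfn (φ ⟨ c ⟩) o h) (a , x) = byContradiction λ none →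
      ⊥ₚ-elim (subst (Sat (all′ s (neg φ))) (map-restrict c o)
        (Equivalence.to (proj₂ elementary (all′ s (neg φ)) c̃)
          (λ (b , b∈M) φb → ⊥-elim (none (b , b∈M , proj₁ (h (b ∷ []))
            (subst (λ c → Sat φ (b ∷ c)) (map-restrict c o)
              (Equivalence.to (proj₂ elementary φ ((b , b∈M) ∷ c̃)) φb))))))
        a (proj₂ (h (a ∷ [])) x))
      where
      c̃ = restrict c o

    abstract
      tarskiVaught : ∀ {Γ X} → Dfn M Γ X → Σ (Tuple Γ) X → Σ[ ρ ∈ Tuple Γ ] ρ ∈* M × X ρ
      tarskiVaught {[]}    D ([] , x)    = [] , (λ ()) , x
      tarskiVaught {s ∷ Γ} {X} D (a ∷ ρ , x) =
        let σ , σ∈M , ∃x = tarskiVaught (dfn-∃ D) (ρ , a , x)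
            b , b∈M , y  = tarskiVaught₁ (dfn-plug-tail {X = X} {b = σ} σ∈M D) ∃x
        in b ∷ σ , ∈*-∷ {M} {ρ = σ} b∈M σ∈M , y

-- The ordinal ω + ω.

module Omega+Omega (ℓ : Level) where

  data Idx : Set ℓ where
    left right : ℕ → Idx

  data _<_ : Idx → Idx → Set ℓ where
    left  : ∀ {m n} → m ℕ.< n → left m < left n
    right : ∀ {m n} → m ℕ.< n → right m < right n
    cross : ∀ {m n} → left m < right n

  <-trans : ∀ {i j k} → i < j → j < k → i < k
  <-trans (left p)  (left q)  = left (ℕₚ.<-trans p q)
  <-trans (left p)  cross     = cross
  <-trans (right p) (right q) = right (ℕₚ.<-trans p q)
  <-trans cross     (right q) = cross

  compare : Trichotomous _≡_ _<_
  compare (left m) (left n) with ℕₚ.<-cmp m n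
  ... | tri< a ¬b ¬c = tri< (left a) (λ { refl → ¬b refl }) (λ { (left c) → ¬c c })
  ... | tri≈ ¬a b ¬c = tri≈ (λ { (left a) → ¬a a }) (cong left b) (λ { (left c) → ¬c c })
  ... | tri> ¬a ¬b c = tri> (λ { (left a) → ¬a a }) (λ { refl → ¬b refl }) (left c)
  compare (right m) (right n) with ℕₚ.<-cmp m n
  ... | tri< a ¬b ¬c = tri< (right a) (λ { refl → ¬b refl }) (λ { (right c) → ¬c c })
  ... | tri≈ ¬a b ¬c = tri≈ (λ { (right a) → ¬a a }) (cong right b) (λ { (right c) → ¬c c })
  ... | tri> ¬a ¬b c = tri> (λ { (right a) → ¬a a }) (λ { refl → ¬b refl }) (right c)
  compare (left m)  (right n) = tri< cross (λ ()) (λ ())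
  compare (right m) (left n)  = tri> (λ ()) (λ ()) cross

  acc-left : ∀ {n} → Acc ℕ._<_ n → Acc _<_ (left n)
  acc-left (acc rs) = acc λ { (left p) → acc-left (rs p) }

  acc-right : ∀ {n} → Acc ℕ._<_ n → Acc _<_ (right n)
  acc-right (acc rs) = acc λ
    { (right p) → acc-right (rs p) ; (cross {m}) → acc-left (ℕ-wellFounded m) }

  ω+ω : Ordinal ℓ
  ω+ω = record
    { Idx                = Idx
    ; _<_                = _<_
    ; isStrictTotalOrder = isStrictTotalOrderᶜ (record
      { isEquivalence = isEquivalence ; trans = <-trans ; compare = compare })
    ; wellFounded        = λ { (left n)  → acc-left (ℕ-wellFounded n)
                             ; (right n) → acc-right (ℕ-wellFounded n) }
    }

  -- The position within a half. A finite set of indices lies among the first `N` positions of the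
  -- two halves, for some `N`.
  weight : Idx → ℕ
  weight (left n)  = n
  weight (right n) = n

  bounded : (is : List Idx) → Σ[ N ∈ ℕ ] (∀ {i} → i ∈ is → weight i ℕ.< N)
  bounded []       = 0 , λ ()
  bounded (i ∷ is) = let N , h = bounded is in ℕ.suc (weight i ℕ.⊔ N) , λ
    { (here refl) → ℕ.s≤s (ℕₚ.m≤m⊔n (weight i) N)
    ; (there j)   → ℕₚ.<-≤-trans (h j) (ℕₚ.≤-trans (ℕₚ.m≤n⊔m (weight i) N) (ℕₚ.n≤1+n _)) }

  infinite : (P : Idx → Set ℓ) (f : ℕ → Idx) → (∀ n → weight (f n) ≡ n) → (∀ n → P (f n)) →
             ¬ Finite (setoid Idx) P
  infinite P f wf Pf (is , h) = let N , b = bounded is in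
    ℕₚ.<-irrefl refl (subst (ℕ._< N) (wf N) (b (h (f N) (Pf N))))

-- Finite and countable Morley sequences and their indiscernibility.

module MorleyLists
  {ℓ : Level} (em : ∀ {a} → ExcludedMiddle a) {L : Language ℓ} (M̄ : Structure L)
  (κ : Cardinal ℓ) (monster : InStructure.IsMonster M̄ κ)
  where

  open Language L
  open Renaming L
  open Structure M̄
  open Semantics M̄
  open InStructure M̄
  open Definable em M̄
  open Types em M̄
  open Saturation em M̄ κ monster

  module _ {s : Sort} (p : GlobalType s) where

    -- A finite Morley sequence in p over B, earliest element first.
    MorleyList : Params → List ∣ s ∣ → Set ℓ
    MorleyList B []       = Unit {ℓ}
    MorleyList B (a ∷ as) = (a ⊩ p ∣ B) × MorleyList (B ∪ ｛ s , a ｝) as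

    Elems : List ∣ s ∣ → Params
    Elems as e = Σ[ a ∈ ∣ s ∣ ] a ∈ as × e ≡ (s , a)

    small-∪-Elems : ∀ {B} as → Small κ B → Small κ (B ∪ Elems as)
    small-∪-Elems []       small = small-mono (λ { (inj₁ b) → b }) small
    small-∪-Elems (a ∷ as) small = small-mono
      (λ { (inj₁ b) → inj₁ (inj₁ b) ; (inj₂ (_ , here refl , refl)) → inj₂ refl
         ; (inj₂ (x , there i , e)) → inj₁ (inj₂ (x , i , e)) })
      (small-∪ (small-∪-Elems as small) (small-single a))

    morley-mono : ∀ {B C} as → B ⊆ C → MorleyList C as → MorleyList B as
    morley-mono []       B⊆C _        = tt
    morley-mono (a ∷ as) B⊆C (r , rs) =
      real-mono B⊆C r , morley-mono as (λ { (inj₁ b) → inj₁ (B⊆C b) ; (inj₂ e) → inj₂ e }) rs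

    morley-++ : ∀ {B} as {bs} → MorleyList B as → MorleyList (B ∪ Elems as) bs →
                MorleyList B (as ++ bs)
    morley-++ [] {bs} _ ms = morley-mono bs inj₁ ms
    morley-++ (a ∷ as) {bs} (r , rs) ms = r , morley-++ as rs (morley-mono bs
      (λ { (inj₁ (inj₁ b)) → inj₁ b ; (inj₁ (inj₂ refl)) → inj₂ (a , here refl , refl)
         ; (inj₂ (x , i , e)) → inj₂ (x , there i , e) }) ms)

    morley-All : ∀ {B} as → MorleyList B as → All (λ a → a ⊩ p ∣ B) as
    morley-All []       _        = []
    morley-All (a ∷ as) (r , rs) = r ∷ All.map (real-mono inj₁) (morley-All as rs)

    morley-sublist : ∀ {B as bs} → Sublist as bs → MorleyList B bs → MorleyList B as
    morley-sublist []                  _        = tt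
    morley-sublist {as = as} (b ∷ʳ σ) (_ , ms) = morley-mono as inj₁ (morley-sublist σ ms)
    morley-sublist (refl ∷ σ)          (r , ms) = r , morley-sublist σ ms

    abstract
      morleyList : ∀ {B} → Small κ B → ∀ n → Σ[ as ∈ List ∣ s ∣ ] length as ≡ n × MorleyList B as
      morleyList small zero      = [] , refl , tt
      morleyList small (ℕ.suc n) =
        let a , r = realiser p small
            as , len , ms = morleyList (small-∪ small (small-single a)) n
        in a ∷ as , cong ℕ.suc len , r , ms

    Before : (ℕ → ∣ s ∣) → ℕ → Params
    Before a n e = Σ[ k ∈ ℕ ] k ℕ.< n × e ≡ (s , a k)

    abstract
      morleySequence : ∀ {B} → Small κ B →
                       Σ[ a ∈ (ℕ → ∣ s ∣) ] (∀ n → a n ⊩ p ∣ (B ∪ Before a n))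
      morleySequence {B} small = a , λ n → real-mono
        (λ { (inj₁ b) → inj₁ b ; (inj₂ (k , k<n , refl)) → inj₂ (a k , occurs k<n , refl) })
        (proj₂ (next (prefix n)))
        where
        next : ∀ as → Σ[ a ∈ ∣ s ∣ ] (a ⊩ p ∣ (B ∪ Elems as))
        next as = realiser p (small-∪-Elems as small)
        -- The latest term comes first here, which is harmless since only the set of elements of the
        -- list is used.
        prefix : ℕ → List ∣ s ∣
        prefix zero      = []
        prefix (ℕ.suc n) = proj₁ (next (prefix n)) ∷ prefix n
        a : ℕ → ∣ s ∣
        a n = proj₁ (next (prefix n))
        occurs : ∀ {k n} → k ℕ.< n → a k ∈ prefix n
        occurs {k} {ℕ.suc n} (ℕ.s≤s k≤n) with ℕₚ.m≤n⇒m<n∨m≡n k≤n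
        ... | inj₁ k<n  = there (occurs k<n)
        ... | inj₂ refl = here refl

    run : (ℕ → ∣ s ∣) → ℕ → ℕ → List ∣ s ∣
    run a k zero      = []
    run a k (ℕ.suc n) = a k ∷ run a (ℕ.suc k) n

    length-run : ∀ a k n → length (run a k n) ≡ n
    length-run a k zero      = refl
    length-run a k (ℕ.suc n) = cong ℕ.suc (length-run a (ℕ.suc k) n)

    run-Range : ∀ {a} k n → Elems (run a k n) ⊆ Range a
    run-Range k (ℕ.suc n) (_ , here refl , refl) = k , refl
    run-Range k (ℕ.suc n) (x , there i , e)      = run-Range (ℕ.suc k) n (x , i , e)

    run-All : ∀ {a k n} {P : ∣ s ∣ → Set ℓ} → All P (run a k n) →
              ∀ i → k ℕ.≤ i → i ℕ.< k ℕ.+ n → P (a i)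
    run-All {k = k} {zero} [] i k≤i i<k =
      ⊥-elim (ℕₚ.<-irrefl refl (ℕₚ.<-≤-trans (subst (i ℕ.<_) (ℕₚ.+-identityʳ k) i<k) k≤i))
    run-All {k = k} {ℕ.suc n} (x ∷ xs) i k≤i i<k+n with ℕₚ.m≤n⇒m<n∨m≡n k≤i
    ... | inj₁ k<i  = run-All xs i k<i (subst (i ℕ.<_) (ℕₚ.+-suc k n) i<k+n)
    ... | inj₂ refl = x

    morley-run : ∀ {B : Params} {a} → (∀ n → a n ⊩ p ∣ (B ∪ Before a n)) →
                 ∀ k n → MorleyList (B ∪ Before a k) (run a k n)
    morley-run h k zero      = tt
    morley-run {a = a} h k (ℕ.suc n) = h k , morley-mono (run a (ℕ.suc k) n)
      (λ { (inj₁ (inj₁ b)) → inj₁ b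
         ; (inj₁ (inj₂ (j , j<k , e))) → inj₂ (j , ℕₚ.m<n⇒m<1+n j<k , e)
         ; (inj₂ refl) → inj₂ (k , ℕₚ.n<1+n k , refl) })
      (morley-run h (ℕ.suc k) n)

    -- Indiscernibility: over A, Morley lists of the same length are conjugate,
    -- so a tuple b′ can be moved along with them.
    abstract
      morley-transfer :
        ∀ {A B B′ Γ Δ} {c c′ : Tuple Γ} → Small κ A → Invariant A p → EqType A c c′ →
        A ⊆ B → A ⊆ B′ → c ∈* B → c′ ∈* B′ → ∀ as as′ → length as ≡ length as′ →
        MorleyList B as → MorleyList B′ as′ → (b′ : Tuple Δ) →
        Σ[ b ∈ Tuple Δ ] EqType A (AllP.++⁺ b c) (AllP.++⁺ b′ c′) ×
                         Pointwise (λ a a′ → EqType A (a ∷ b) (a′ ∷ b′)) as as′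
      morley-transfer small inv e _ _ _ _ [] [] _ _ _ b′ =
        let b , e′ = transfer small e b′ in b , e′ , []
      morley-transfer {A} {B} {B′} {Γ} {Δ} {c} {c′} small inv e A⊆B A⊆B′ c∈B c′∈B′
                      (a ∷ as) (a′ ∷ as′) len (r , ms) (r′ , ms′) b′ =
        let b , e′ , pw = morley-transfer small inv extended (λ x → inj₁ (A⊆B x)) (λ x → inj₁ (A⊆B′ x))
                            (∈*-∷ {B ∪ ｛ s , a ｝} {ρ = c} (inj₂ refl) (λ i → inj₁ (c∈B i)))
                            (∈*-∷ {B′ ∪ ｛ s , a′ ｝} {ρ = c′} (inj₂ refl) (λ i → inj₁ (c′∈B′ i)))
                            as as′ (ℕₚ.suc-injective len) ms ms′ b′
        in b , eq-ren (drop b a c) (drop b′ a′ c′) e′ , eq-ren (pick b a c) (pick b′ a′ c′) e′ ∷ pw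
        where
        -- A formula true of `a` and `c` has its fibre at `c` in p, by invariance also its fibre at
        -- `c′`, and `a′` realises p over a set containing `c′`.
        extended : EqType A (a ∷ c) (a′ ∷ c′)
        extended = eq-intro λ φ o acφ →
          real-in r′ (dfn-plug-tail {X = _⊨ φ} {b = c′} c′∈B′ (dfn-mono A⊆B′ (dfn-over φ o)))
            (inv-in {X = _⊨ φ} {p = p} inv e (dfn-over φ o)
              (in-real r (dfn-plug-tail {X = _⊨ φ} {b = c} c∈B (dfn-mono A⊆B (dfn-over φ o))) acφ))
        drop : ∀ b a c → Agree (copair {Δ} inl (inr Δ ∘ there)) (AllP.++⁺ b (a ∷ c)) (AllP.++⁺ b c)
        drop b a c = agree-copair b c (agree-inl b _)
          (agree-∘ {f = there} {g = inr Δ} {δ = a ∷ c} (agree-inr b _) (agree (λ _ → refl)))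
        pick₀ : Ren [ s ] (Δ ++ s ∷ Γ)
        pick₀ i = inr Δ (inl i)
        pick : ∀ b a c → Agree (copair {[ s ]} pick₀ inl) (AllP.++⁺ b (a ∷ c)) (a ∷ b)
        pick b a c = agree-copair {f = pick₀} {g = inl} (a ∷ []) b
          (agree-∘ {f = inl} {g = inr Δ} (agree-inr b _) (agree-inl (a ∷ []) c)) (agree-inl b _)

-- Generic stability: definability of p and symmetry of independence.

module GenericStability
  {ℓ : Level} (em : ∀ {a} → ExcludedMiddle a) {L : Language ℓ} (M̄ : Structure L)
  (κ : Cardinal ℓ) (monster : InStructure.IsMonster M̄ κ)
  where

  open Language L
  open Renaming L
  open Structure M̄
  open Semantics M̄
  open InStructure M̄
  open Definable em M̄
  open Types em M̄
  open Saturation em M̄ κ monster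
  open MorleyLists em M̄ κ monster
  open Omega+Omega ℓ

  Stable : ∀ {s} → GlobalType s → Params → Set (suc ℓ)
  Stable {s} p A = ∀ (α : Ordinal ℓ) → let I = setoid (Ordinal.Idx α) in
    ¬ Finite I (λ _ → Unit) →
    ∀ (a : Ordinal.Idx α → ∣ s ∣) → Morley α a p A →
    ∀ (φ : PFormula [ s ]) →
      Finite I (λ i → (a i ∷ []) ⊨ φ) ⊎ Finite I (λ i → ¬ ((a i ∷ []) ⊨ φ))

  module _ {s : Sort} (p : GlobalType s) (A : Params) (smallA : Small κ A)
           (invA : Invariant A p) (stable : Stable p A) where

    private
      first : Σ[ a ∈ (ℕ → ∣ s ∣) ] (∀ n → a n ⊩ p ∣ (A ∪ Before p a n))
      first = morleySequence p smallA
      a₁ = proj₁ first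
      -- Realising p over the whole range of the first sequence places the second one after it,
      -- which gives the type ω + ω.
      second : Σ[ a ∈ (ℕ → ∣ s ∣) ] (∀ n → a n ⊩ p ∣ ((A ∪ Range a₁) ∪ Before p a n))
      second = morleySequence p (small-∪ smallA (small-Range a₁))
      a₂ = proj₁ second

      a : Idx → ∣ s ∣
      a (left n)  = a₁ n
      a (right n) = a₂ n

      a-Morley : Morley ω+ω a p A
      a-Morley (left n)  = satisfies (real-mono {B = A ∪ initialPart ω+ω a (left n)}
        (λ { (inj₁ x) → inj₁ x ; (inj₂ (left k , left k<n , e)) → inj₂ (k , k<n , e) })
        (proj₂ first n))
      a-Morley (right n) = satisfies (real-mono {B = A ∪ initialPart ω+ω a (right n)}
        (λ { (inj₁ x) → inj₁ (inj₁ x) ; (inj₂ (left k , _ , e)) → inj₁ (inj₂ (k , e))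
           ; (inj₂ (right k , right k<n , e)) → inj₂ (k , k<n , e) })
        (proj₂ second n))

    module _ {Γ : List Sort} (φ : Formula L (s ∷ Γ)) where

      Cut : Idx → Tuple Γ → Set ℓ
      Cut (left n)  b = Sat φ (a₁ n ∷ b)
      Cut (right n) b = ¬ Sat φ (a₂ n ∷ b)

      -- Along a cut both the formula and its negation hold on a whole half, so neither set of
      -- indices is finite.
      no-cut : ¬ (Σ[ b ∈ Tuple Γ ] ∀ i → Cut i b)
      no-cut (b , h) with stable ω+ω (infinite (λ _ → Unit) left (λ _ → refl) (λ _ → tt)) a a-Morley (φ ⟨ b ⟩)
      ... | inj₁ fin = infinite (λ i → (a i ∷ []) ⊨ (φ ⟨ b ⟩)) left (λ _ → refl) (λ n → h (left n)) fin
      ... | inj₂ fin = infinite (λ i → ¬ ((a i ∷ []) ⊨ (φ ⟨ b ⟩))) right (λ _ → refl) (λ n → h (right n)) fin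

      private
        dfn-Cut : ∀ i → Dfn (Range a₁ ∪ Range a₂) Γ (Cut i)
        dfn-Cut (left n)  = dfn-plug (inj₁ (n , refl)) (dfn-formula φ)
        dfn-Cut (right n) = dfn-¬ (dfn-plug (inj₂ (n , refl)) (dfn-formula φ))

        compact = compactness (small-∪ (small-Range a₁) (small-Range a₂)) dfn-Cut no-cut
        -- The finitely many conditions left by compactness concern positions below `N`, so the
        -- first `N` terms of each half are already incompatible with a cut.
        N = proj₁ (bounded (proj₁ compact))

      bounded-cut : ∀ b → All (λ x → Sat φ (x ∷ b)) (run p a₁ 0 N) →
                    ¬ All (λ x → ¬ Sat φ (x ∷ b)) (run p a₂ 0 N)
      bounded-cut b pos neg = proj₂ compact b (All.tabulate λ {i} i∈is → cut i
        (proj₂ (bounded (proj₁ compact)) i∈is))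
        where
        cut : ∀ i → weight i ℕ.< N → Cut i b
        cut (left n)  n<N = run-All p pos n ℕ.z≤n n<N
        cut (right n) n<N = run-All p neg n ℕ.z≤n n<N

      private
        reference : List ∣ s ∣
        reference = run p a₁ 0 N ++ run p a₂ 0 N

        reference-Morley : MorleyList p A reference
        reference-Morley = morley-++ p (run p a₁ 0 N)
          (morley-mono p (run p a₁ 0 N) inj₁ (morley-run p (proj₂ first) 0 N))
          (morley-mono p (run p a₂ 0 N)
            (λ { (inj₁ x) → inj₁ (inj₁ x) ; (inj₂ e) → inj₁ (inj₂ (run-Range p 0 N e)) })
            (morley-run p (proj₂ second) 0 N))

        transport : ∀ {xs ys us vs} {b c : Tuple Γ} → length xs ≡ length us →
          Pointwise (λ x u → EqType A (x ∷ b) (u ∷ c)) (xs ++ ys) (us ++ vs) →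
          All (λ u → Sat φ (u ∷ c)) us → All (λ v → ¬ Sat φ (v ∷ c)) vs →
          All (λ x → Sat φ (x ∷ b)) xs × All (λ y → ¬ Sat φ (y ∷ b)) ys
        transport {[]} {[]} {[]} _ [] [] [] = [] , []
        transport {[]} {_ ∷ ys} {[]} len (e ∷ pw) [] (v ∷ vs) =
          let _ , negs = transport {[]} {ys} {[]} refl pw [] vs
          in [] , eq-dfn (eq-sym e) (dfn-¬ (dfn-formula φ)) v ∷ negs
        transport {_ ∷ xs} {us = _ ∷ us} len (e ∷ pw) (u ∷ pos) vs =
          let poss , negs = transport {xs} (ℕₚ.suc-injective len) pw pos vs
          in eq-dfn (eq-sym e) (dfn-formula φ) u ∷ poss , negs

      -- Otherwise the list can be continued by realisations of p omitting φ(x, b),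
      -- and the cut so obtained is moved onto the fixed sequence of type ω + ω.
      abstract
        stable-bound : Σ[ N ∈ ℕ ] (∀ (b : Tuple Γ) as → length as ≡ N → MorleyList p A as →
                       All (λ x → Sat φ (x ∷ b)) as → In p (λ x → Sat φ (x ∷ b)))
        stable-bound = N , λ b as len ms pos → byContradiction λ φ∉p →
          let small = small-∪-entries b (small-∪-Elems p as smallA)
              bs , len′ , ms′ = morleyList p small N
              φ-over : Dfn₁ ((A ∪ Elems p as) ∪ Entries b) s (λ x → Sat φ (x ∷ b))
              φ-over = dfn-plug-tail {b = b} (λ i → inj₂ (entries {c = b} i)) (dfn-formula φ)
              neg = All.map (λ r φx → φ∉p (in-real r φ-over φx)) (morley-All p bs ms′)
              b₀ , _ , pw = morley-transfer p {B = A} {B′ = A} {c = []} {c′ = []} smallA invA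
                (eq-intro (λ _ _ h → h)) id id (λ ()) (λ ())
                reference (as ++ bs) (lengths as bs len len′) reference-Morley
                (morley-++ p as ms (morley-mono p bs inj₁ ms′)) b
              pos₀ , neg₀ = transport (trans (length-run p a₁ 0 N) (sym len)) pw pos neg
          in bounded-cut b₀ pos₀ neg₀
          where
          lengths : ∀ (as bs : List ∣ s ∣) → length as ≡ N → length bs ≡ N →
                    length reference ≡ length (as ++ bs)
          lengths as bs len len′ = trans (length-++ (run p a₁ 0 N)) (trans
            (cong₂ ℕ._+_ (trans (length-run p a₁ 0 N) (sym len)) (trans (length-run p a₂ 0 N) (sym len′)))
            (sym (length-++ as)))

    -- Counting by recursion along the list exhibits the condition as a Boolean combination of its
    -- instances at the entries, hence as a definable one.
    AtLeast : ℕ → (∣ s ∣ → Set ℓ) → List ∣ s ∣ → Set ℓ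
    AtLeast zero      P as       = Unit
    AtLeast (ℕ.suc n) P []       = ⊥
    AtLeast (ℕ.suc n) P (a ∷ as) = (P a × AtLeast n P as) ⊎ AtLeast (ℕ.suc n) P as

    atLeast-sublist : ∀ n {P : ∣ s ∣ → Set ℓ} as → AtLeast n P as →
                      Σ[ bs ∈ List ∣ s ∣ ] Sublist bs as × length bs ≡ n × All P bs
    atLeast-sublist zero [] _ = [] , [] , refl , []
    atLeast-sublist zero (a ∷ as) _ =
      let bs , σ , len , all = atLeast-sublist zero as tt in bs , a ∷ʳ σ , len , all
    atLeast-sublist (ℕ.suc n) (a ∷ as) (inj₁ (x , h)) =
      let bs , σ , len , all = atLeast-sublist n as h
      in a ∷ bs , refl ∷ σ , cong ℕ.suc len , x ∷ all
    atLeast-sublist (ℕ.suc n) (a ∷ as) (inj₂ h) =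
      let bs , σ , len , all = atLeast-sublist (ℕ.suc n) as h in bs , a ∷ʳ σ , len , all

    atLeast-dichotomy : ∀ m n (P : ∣ s ∣ → Set ℓ) as → length as ≡ m ℕ.+ n →
                        AtLeast m P as ⊎ AtLeast n (λ x → ¬ P x) as
    atLeast-dichotomy zero      n         P as       len = inj₁ tt
    atLeast-dichotomy (ℕ.suc m) zero      P as       len = inj₂ tt
    atLeast-dichotomy (ℕ.suc m) (ℕ.suc n) P (a ∷ as) len with em {P = P a}
    ... | yes x with atLeast-dichotomy m (ℕ.suc n) P as (ℕₚ.suc-injective len)
    ...   | inj₁ h = inj₁ (inj₁ (x , h))
    ...   | inj₂ h = inj₂ (inj₂ h)
    atLeast-dichotomy (ℕ.suc m) (ℕ.suc n) P (a ∷ as) len | no ¬x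
      with atLeast-dichotomy (ℕ.suc m) n P as (trans (ℕₚ.suc-injective len) (ℕₚ.+-suc m n))
    ...   | inj₁ h = inj₁ (inj₂ h)
    ...   | inj₂ h = inj₂ (inj₁ (¬x , h))

    dfn-AtLeast : ∀ {Γ} (φ : Formula L (s ∷ Γ)) n as →
                  Dfn (Elems p as) Γ (λ b → AtLeast n (λ x → Sat φ (x ∷ b)) as)
    dfn-AtLeast φ zero      as = dfn-ext (λ _ → (λ _ → tt) , (λ _ z → z)) (dfn-⇒ dfn-⊥ dfn-⊥)
    dfn-AtLeast φ (ℕ.suc n) [] = dfn-⊥
    dfn-AtLeast φ (ℕ.suc n) (a ∷ as) = dfn-⊎
      (dfn-× (dfn-plug (a , here refl , refl) (dfn-formula φ)) (dfn-mono later (dfn-AtLeast φ n as)))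
      (dfn-mono later (dfn-AtLeast φ (ℕ.suc n) as))
      where
      later : Elems p as ⊆ Elems p (a ∷ as)
      later (x , i , e) = x , there i , e

    Bound : ∀ {Γ} → Formula L (s ∷ Γ) → ℕ → Set ℓ
    Bound {Γ} φ n = ∀ (b : Tuple Γ) as → length as ≡ n → MorleyList p A as →
      All (λ x → Sat φ (x ∷ b)) as → In p (λ x → Sat φ (x ∷ b))

    -- Among `m + n` entries either `m` satisfy φ(x, b) or `n` satisfy its negation. Such a sublist
    -- is again Morley, so the bound for φ or for its negation decides on which side p lies.
    majority : ∀ {Γ} (φ : Formula L (s ∷ Γ)) m n → Bound φ m → Bound (neg φ) n →
               ∀ as → length as ≡ m ℕ.+ n → MorleyList p A as → ∀ b →
               AtLeast m (λ x → Sat φ (x ∷ b)) as ↔ In p (λ x → Sat φ (x ∷ b))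
    majority φ m n bound bound¬ as len ms b = positive , λ i → byContradiction (negative i)
      where
      positive : AtLeast m (λ x → Sat φ (x ∷ b)) as → In p (λ x → Sat φ (x ∷ b))
      positive h = let bs , σ , len , all = atLeast-sublist m as h in
        bound b bs len (morley-sublist p σ ms) all
      negative : In p (λ x → Sat φ (x ∷ b)) → ¬ ¬ AtLeast m (λ x → Sat φ (x ∷ b)) as
      negative i few with atLeast-dichotomy m n (λ x → Sat φ (x ∷ b)) as len
      ... | inj₁ h = few h
      ... | inj₂ h = let bs , σ , len , all = atLeast-sublist n as h in
        in-disjoint p i (in-mono {p = p} (λ x ¬φx φx → ⊥ₚ-elim (¬φx φx))
          (bound¬ b bs len (morley-sublist p σ ms) (All.map (λ ¬φx φx → ⊥-elim (¬φx φx)) all)))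

    abstract
      -- The voting list is Morley over `A`, where generic stability is given. The predicate it
      -- defines is invariant over `M` because p is, so `dfn-invariant` exchanges the list for
      -- parameters in `M`.
      definable : ∀ {Γ M} → Small κ M → Invariant M p → (φ : Formula L (s ∷ Γ)) →
                  Dfn M Γ (λ b → In p (λ x → Sat φ (x ∷ b)))
      definable {Γ} {M} smallM invM φ =
        from (stable-bound φ) (stable-bound (neg φ))
        where
        from : Σ ℕ (Bound φ) → Σ ℕ (Bound (neg φ)) → Dfn M Γ (λ b → In p (λ x → Sat φ (x ∷ b)))
        from (m , bound) (n , bound¬) = let as , len , ms = morleyList p smallA (m ℕ.+ n) in
          dfn-invariant smallM (small-∪-Elems p as smallM) inj₁
            (dfn-mono inj₂ (dfn-ext (majority φ m n bound bound¬ as len ms) (dfn-AtLeast φ m as)))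
            (λ e → inv-in {p = p} invM e (dfn-formula φ))

      definable-fibres : ∀ {Γ M X} → Small κ M → Invariant M p → Dfn M (s ∷ Γ) X →
                         Dfn M Γ (λ b → In p (λ x → X (x ∷ b)))
      definable-fibres smallM invM (dfn (φ ⟨ c ⟩) o h) = dfn-ext
        (λ b → in-mono {p = p} (λ x → proj₁ (h (x ∷ b))) , in-mono {p = p} (λ x → proj₂ (h (x ∷ b))))
        (dfn-plug-right {d = c} o (definable smallM invM φ))

    -- Suppose W(x, b) is in p but W(a, b) fails. Let `b*` realise q over `B` and a long Morley list
    -- in p over `B`. Each entry of the list has the type of `a` over `B`, so by invariance of q it
    -- satisfies ¬W(x, b*). Hence ¬W(x, b*) is in p by `stable-bound`, while W(x, b*) is in p
    -- because `b` and `b*` are conjugate over `B`.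
    symmetric : ∀ {B t} {q : GlobalType t} {a : ∣ s ∣} {b : ∣ t ∣} → Small κ B → A ⊆ B →
                Invariant B q → a ⊩ p ∣ B → b ⊩ q ∣ (B ∪ ｛ s , a ｝) → a ⊩ p ∣ (B ∪ ｛ t , b ｝)
    symmetric {B} {t} {q} {a} {b} smallB A⊆B invq ra rb = real-intro λ {X} D X∈p →
      byContradiction λ ¬Xa → let Y , D′ , X↔Y = dfn-unplug D in
        contradict (dfn-swap D′)
          (in-mono {p = p} (λ x → proj₁ (X↔Y (x ∷ []))) X∈p)
          (λ y → ¬Xa (proj₂ (X↔Y (a ∷ [])) y))
      where
      contradict : ∀ {W} → Dfn B (s ∷ t ∷ []) W → In p (λ x → W (x ∷ b ∷ [])) →
                   ¬ ¬ W (a ∷ b ∷ [])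
      contradict {W} D@(dfn (χ ⟨ c ⟩) o h) W∈p ¬Wab =
        in-disjoint p
          (inv-in {X = W} {p = p} (inv-mono {A = A} {B} {p} A⊆B invA)
            (eq-realisers id (λ ()) (real-mono {B = B} inj₁ rb) (real-mono {B = B} inj₁ rb*)) D W∈p)
          (in-mono {p = p} (λ x k w → ⊥ₚ-elim (k (proj₂ (h (x ∷ b* ∷ [])) w)))
            (proj₂ (stable-bound (neg χ)) (b* ∷ c) as len (morley-mono p as A⊆B ms)
              (All.tabulate λ {a*} a*∈as χx →
                ⊥-elim (¬Wa*b* a*∈as (proj₁ (h (a* ∷ b* ∷ [])) χx)))))
        where
        list = morleyList p smallB (proj₁ (stable-bound (neg χ)))
        as   = proj₁ list
        len  = proj₁ (proj₂ list)
        ms   = proj₂ (proj₂ list)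
        new  = realiser q (small-∪-Elems p as smallB)
        b*   = proj₁ new
        rb*  = proj₂ new
        D¬ : Dfn B (t ∷ s ∷ []) (λ ρ → ¬ W (swap ρ))
        D¬ = dfn-¬ (dfn-swap D)
        ¬Wa*b* : ∀ {a*} → a* ∈ as → ¬ W (a* ∷ b* ∷ [])
        ¬Wa*b* {a*} a*∈as = real-in rb*
          (dfn-plug-tail {X = λ ρ → ¬ W (swap ρ)} {b = a* ∷ []}
            (λ { (here refl) → inj₂ (a* , a*∈as , refl) }) (dfn-mono inj₁ D¬))
          (inv-in {X = λ ρ → ¬ W (swap ρ)} {p = q} invq
            (eq-realisers id (λ ()) ra (All.lookup (morley-All p as ms) a*∈as)) D¬
            (in-real rb
              (dfn-plug-tail {X = λ ρ → ¬ W (swap ρ)} {b = a ∷ []}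
                (λ { (here refl) → inj₂ refl }) (dfn-mono inj₁ D¬))
              ¬Wab))

-- Strong regularity and weight one.

module StrongRegularity
  {ℓ : Level} (em : ∀ {a} → ExcludedMiddle a) {L : Language ℓ} (M̄ : Structure L)
  (κ : Cardinal ℓ) (monster : InStructure.IsMonster M̄ κ)
  where

  open Language L
  open Renaming L
  open Structure M̄
  open Semantics M̄
  open InStructure M̄
  open Definable em M̄
  open Types em M̄
  open Saturation em M̄ κ monster
  open MorleyLists em M̄ κ monster
  open GenericStability em M̄ κ monster

  Regular : ∀ {s} → GlobalType s → PFormula [ s ] → Params → Set (suc ℓ)
  Regular {s} p φ A = ∀ (B : Params) → Small κ B → A ⊆ B →
    ∀ (a : ∣ s ∣) → (a ∷ []) ⊨ φ →
      (a realises (p ↾ B)) ⊎ ((p ↾ B) ⊢ (p ↾ (B ∪ ｛ s , a ｝)))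

  -- Regularity enters the proof in this form: a point of φ that is not generic over `B` does not
  -- disturb genericity over `B`.
  regular-adjoin : ∀ {s A B φ} {p : GlobalType s} {a e : ∣ s ∣} → Regular p φ A →
                   Small κ B → A ⊆ B → (a ∷ []) ⊨ φ → ¬ (a ⊩ p ∣ B) →
                   e ⊩ p ∣ B → e ⊩ p ∣ (B ∪ ｛ s , a ｝)
  regular-adjoin {B = B} {a = a} {e} reg small A⊆B φa ¬ra re with reg B small A⊆B a φa
  ... | inj₁ ra = ⊥-elim (¬ra (real ra))
  ... | inj₂ p⊢ = real λ ψ p∋ψ → let φs , p∋φs , imp = p⊢ ψ p∋ψ in
    imp e (All.map (λ {φ} p∋φ → satisfies re φ p∋φ) p∋φs)

  module _ {s : Sort} (p : GlobalType s) (A : Params) (smallA : Small κ A)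
           (invA : Invariant A p) (stable : Stable p A)
           (φp : PFormula [ s ]) (R : Params) (regular : Regular p φp R)
           {t : Sort} (q : GlobalType t) where

    module _ (N : Params) (smallN : Small κ N) (A⊆N : A ⊆ N) (R⊆N : R ⊆ N)
             (invq : Invariant N q) (p∋φp : Type._∋_ (p ↾ N) φp) where

      -- What is independent of `b₁` is independent of `a₁`, which depends on `b₁`. By symmetry an
      -- entry `x` realises p over `B` and `b₁`; there `a₁` does not realise p, as `W` shows, so
      -- regularity lets `a₁` be adjoined. The next entry is treated over `B` and `x`.
      independent : ∀ {B W a₁ b₁} as → Small κ B → N ⊆ B → Dfn N (s ∷ t ∷ []) W →
                    W (a₁ ∷ b₁ ∷ []) → In p (λ x → ¬ W (x ∷ b₁ ∷ [])) → (a₁ ∷ []) ⊨ φp →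
                    MorleyList p B as → b₁ ⊩ q ∣ (B ∪ Elems p as) →
                    MorleyList p (B ∪ ｛ s , a₁ ｝) as
      independent [] _ _ _ _ _ _ _ _ = tt
      independent {B} {W} {a₁} {b₁} (x ∷ as) smallB N⊆B D w ¬w φa₁ (rx , ms) rb₁ =
        real-mono (λ { (inj₁ i) → inj₁ (inj₁ i) ; (inj₂ i) → inj₂ i }) adjoined ,
        morley-mono p as
          (λ { (inj₁ (inj₁ i)) → inj₁ (inj₁ i) ; (inj₁ (inj₂ i)) → inj₂ i ; (inj₂ i) → inj₁ (inj₂ i) })
          (independent as (small-∪ smallB (small-single x)) (λ i → inj₁ (N⊆B i)) D w ¬w φa₁ ms
            (real-mono (λ { (inj₁ (inj₁ i)) → inj₁ i ; (inj₁ (inj₂ refl)) → inj₂ (x , here refl , refl)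
                          ; (inj₂ (y , i , e)) → inj₂ (y , there i , e) }) rb₁))
        where
        rx′ : x ⊩ p ∣ (B ∪ ｛ t , b₁ ｝)
        rx′ = symmetric p A smallA invA stable smallB (λ i → N⊆B (A⊆N i))
          (inv-mono {A = N} {B} {q} N⊆B invq) rx
          (real-mono (λ { (inj₁ i) → inj₁ i ; (inj₂ refl) → inj₂ (x , here refl , refl) }) rb₁)
        adjoined : x ⊩ p ∣ ((B ∪ ｛ t , b₁ ｝) ∪ ｛ s , a₁ ｝)
        adjoined = regular-adjoin {φ = φp} {p = p} regular (small-∪ smallB (small-single b₁))
          (λ i → inj₁ (N⊆B (R⊆N i))) φa₁
          (¬real (dfn-plug-tail {X = W} {b = b₁ ∷ []} (λ { (here refl) → inj₂ refl })
                   (dfn-mono (λ i → inj₁ (N⊆B i)) D)) ¬w w)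
          rx′

      -- p has weight one: a realisation a of p ↾ N cannot depend on both of the
      -- independent elements b and b′.  Otherwise conjugates of a over N b′ form
      -- arbitrarily long Morley lists, all satisfying the formula W′(x, b′) ∉ p.
      weight-one : ∀ {u a b} {b′ : ∣ u ∣} {W W′} → a ⊩ p ∣ N → b ⊩ q ∣ (N ∪ ｛ u , b′ ｝) →
                   Dfn N (s ∷ t ∷ []) W → W (a ∷ b ∷ []) → In p (λ x → ¬ W (x ∷ b ∷ [])) →
                   Dfn N (s ∷ u ∷ []) W′ → W′ (a ∷ b′ ∷ []) → ¬ In p (λ x → ¬ W′ (x ∷ b′ ∷ []))
      weight-one {u} {a} {b} {b′} {W} {W′} ra rb D w ¬w D′@(dfn (χ ⟨ c ⟩) o h) w′ ¬w′ =
        in-disjoint p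
          (in-mono {p = p} (λ x → proj₁ (h (x ∷ b′ ∷ [])))
            (bound (b′ ∷ c) as len (morley-mono p as A⊆N ms)
              (All.map (λ {x} → proj₂ (h (x ∷ b′ ∷ []))) all)))
          ¬w′
        where
        build : ∀ n → Σ[ as ∈ List ∣ s ∣ ] length as ≡ n × MorleyList p N as ×
                                          All (λ x → W′ (x ∷ b′ ∷ [])) as
        build zero = [] , refl , tt , []
        -- The list grows at the front. The copy `b₁` of `b` over `N` and `b′` is generic over the
        -- list built so far, and `a₁` is to `b₁` and `b′` as `a` is to `b` and `b′`. Since `a₁`
        -- depends on `b₁`, `independent` keeps the old list Morley over `N` and `a₁`.
        build (ℕ.suc n) =
          let as , len , ms , all = build n
              b₁ , rb₁ = realiser q (small-∪-Elems p as (small-∪ smallN (small-single b′)))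
              e : EqType N (b ∷ b′ ∷ []) (b₁ ∷ b′ ∷ [])
              e = eq-realisers inj₁ (λ { (here refl) → inj₂ refl }) rb (real-mono inj₁ rb₁)
              a₁ , e₁ = transfer₁ smallN (eq-sym e) a
              φa₁ = satisfies (real-eq (eq-sym (first e₁)) ra) φp p∋φp
          in a₁ ∷ as , cong ℕ.suc len ,
             (real-eq (eq-sym (first e₁)) ra ,
              independent as smallN id D (eq-dfn (eq-sym (pair₁₂ e₁)) D w)
                (inv-in {X = λ ρ → ¬ W ρ} {p = p} (inv-mono {A = A} {N} {p} A⊆N invA)
                  (head₁ e) (dfn-¬ D) ¬w)
                φa₁ ms
                (real-mono (λ { (inj₁ i) → inj₁ (inj₁ i) ; (inj₂ i) → inj₂ i }) rb₁)) ,
             eq-dfn (eq-sym (pair₁₃ e₁)) D′ w′ ∷ all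
          where
          head₁ : ∀ {v w} {x y : ∣ v ∣} {x′ y′ : ∣ w ∣} →
                  EqType N (x ∷ x′ ∷ []) (y ∷ y′ ∷ []) → EqType N (x ∷ []) (y ∷ [])
          head₁ {v} {w} = eq-ren {f = inl {v ∷ []} {w ∷ []}} (agree-inl _ _) (agree-inl _ _)
          first : ∀ {x y x′ y′ x″ y″} → EqType N (x ∷ x′ ∷ x″ ∷ []) (y ∷ y′ ∷ y″ ∷ []) →
                  EqType N {s ∷ []} (x ∷ []) (y ∷ [])
          first = eq-ren {Θ = s ∷ t ∷ u ∷ []} {f = inl {s ∷ []}} (agree-inl _ _) (agree-inl _ _)
          pair₁₂ : ∀ {x y x′ y′ x″ y″} → EqType N (x ∷ x′ ∷ x″ ∷ []) (y ∷ y′ ∷ y″ ∷ []) →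
                   EqType N {s ∷ t ∷ []} (x ∷ x′ ∷ []) (y ∷ y′ ∷ [])
          pair₁₂ = eq-ren {Θ = s ∷ t ∷ u ∷ []} {f = inl {s ∷ t ∷ []}} (agree-inl _ _) (agree-inl _ _)
          pair₁₃ : ∀ {x y x′ y′ x″ y″} → EqType N (x ∷ x′ ∷ x″ ∷ []) (y ∷ y′ ∷ y″ ∷ []) →
                   EqType N {s ∷ u ∷ []} (x ∷ x″ ∷ []) (y ∷ y″ ∷ [])
          pair₁₃ {x} {y} {x′} {y′} {x″} {y″} = eq-ren {Θ = s ∷ t ∷ u ∷ []} {f = lift there}
            (agree-lift (agree (λ _ → refl)) x) (agree-lift (agree (λ _ → refl)) y)
        -- The length that forces membership in p for χ, where W′(x, b′) is χ(x, b′, c).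
        N₀    = proj₁ (stable-bound p A smallA invA stable χ)
        bound = proj₂ (stable-bound p A smallA invA stable χ)
        built = build N₀
        as    = proj₁ built
        len   = proj₁ (proj₂ built)
        ms    = proj₁ (proj₂ (proj₂ built))
        all   = proj₂ (proj₂ (proj₂ built))

  -- Weak orthogonality in terms of realisations.

  union-realised : ∀ {s t B θ} {p : GlobalType s} {q : GlobalType t} {a : ∣ s ∣} {b : ∣ t ∣} →
                   UnionProves (p ↾ B) (q ↾ B) θ → a ⊩ p ∣ B → b ⊩ q ∣ B → (a ∷ b ∷ []) ⊨ θ
  union-realised {a = a} {b} (φs , ψs , p∋φs , q∋ψs , imp) ra rb = imp a b
    (All.map (λ {φ} → satisfies ra φ) p∋φs) (All.map (λ {ψ} → satisfies rb ψ) q∋ψs)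

  orthogonal-decides : ∀ {s t B X} {p : GlobalType s} {q : GlobalType t} →
    WeaklyOrthogonal (p ↾ B) (q ↾ B) → Dfn B (s ∷ t ∷ []) X →
    (∀ {a b} → a ⊩ p ∣ B → b ⊩ q ∣ B → X (a ∷ b ∷ [])) ⊎
    (∀ {a b} → a ⊩ p ∣ B → b ⊩ q ∣ B → ¬ X (a ∷ b ∷ []))
  orthogonal-decides {p = p} {q} orth (dfn θ o h) with orth θ o
  ... | inj₁ proves  = inj₁ λ ra rb → proj₁ (h _) (union-realised {θ = θ} {p = p} {q} proves ra rb)
  ... | inj₂ refutes = inj₂ λ ra rb x → ⊥ₚ-elim
    (union-realised {θ = not θ} {p = p} {q} refutes ra rb (proj₂ (h _) x))

  -- If p ↾ B, q ↾ B and the negation of θ were not finitely satisfiable together, the formulas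
  -- involved would be a proof of θ. The types are restricted to a small `B` so that saturation
  -- provides realisations inside the monster model.
  union-countermodel : ∀ {s t B} {p : GlobalType s} {q : GlobalType t} θ → Small κ B → θ over B →
                       ¬ UnionProves p q θ →
                       Σ[ a ∈ ∣ s ∣ ] Σ[ b ∈ ∣ t ∣ ] (a ⊩ p ∣ B) × (b ⊩ q ∣ B) × ¬ ((a ∷ b ∷ []) ⊨ θ)
  union-countermodel {s} {t} {B} {p} {q} θ small o unprovable = found
    (saturation {X = X} small D λ is → byContradiction λ none →
      let φs , ψs , p∋φs , q∋ψs , imp = gather is in
      unprovable (φs , ψs , p∋φs , q∋ψs , λ a b φsa ψsb →
        byContradiction λ ¬θ → none (a ∷ b ∷ [] , imp a b φsa ψsb ¬θ)))
    where
    open Type using (_∋_)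
    I : Set ℓ
    I = Σ (PFormula [ s ]) ((p ↾ B) ∋_) ⊎ Σ (PFormula [ t ]) ((q ↾ B) ∋_) ⊎ Unit {ℓ}
    X : I → Tuple (s ∷ t ∷ []) → Set ℓ
    X (inj₁ (φ , _))        ρ = (All.head ρ ∷ []) ⊨ φ
    X (inj₂ (inj₁ (ψ , _))) ρ = All.tail ρ ⊨ ψ
    X (inj₂ (inj₂ _))       ρ = ¬ (ρ ⊨ θ)
    D : ∀ i → Dfn B (s ∷ t ∷ []) (X i)
    D (inj₁ (φ , _ , oφ)) = dfn-ren inl (λ ρ → All.head ρ ∷ [])
      (λ { (a ∷ b ∷ []) → agree-inl (a ∷ []) (b ∷ []) }) (dfn-over φ oφ)
    D (inj₂ (inj₁ (ψ , _ , oψ))) = dfn-weaken (dfn-over ψ oψ)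
    D (inj₂ (inj₂ _)) = dfn-¬ (dfn-over θ o)
    gather : ∀ is → Σ[ φs ∈ List (PFormula [ s ]) ] Σ[ ψs ∈ List (PFormula [ t ]) ]
      All (p ∋_) φs × All (q ∋_) ψs ×
      (∀ a b → All ((a ∷ []) ⊨_) φs → All ((b ∷ []) ⊨_) ψs → ¬ ((a ∷ b ∷ []) ⊨ θ) →
               All (λ i → X i (a ∷ b ∷ [])) is)
    gather [] = [] , [] , [] , [] , λ _ _ _ _ _ → []
    gather (inj₁ (φ , p∋φ , _) ∷ is) = let φs , ψs , h , k , imp = gather is in
      φ ∷ φs , ψs , p∋φ ∷ h , k , λ { a b (x ∷ xs) ys n → x ∷ imp a b xs ys n }
    gather (inj₂ (inj₁ (ψ , q∋ψ , _)) ∷ is) = let φs , ψs , h , k , imp = gather is in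
      φs , ψ ∷ ψs , h , q∋ψ ∷ k , λ { a b xs (y ∷ ys) n → y ∷ imp a b xs ys n }
    gather (inj₂ (inj₂ _) ∷ is) = let φs , ψs , h , k , imp = gather is in
      φs , ψs , h , k , λ a b xs ys n → n ∷ imp a b xs ys n
    found : Σ[ ρ ∈ Tuple (s ∷ t ∷ []) ] (∀ i → X i ρ) →
            Σ[ a ∈ ∣ s ∣ ] Σ[ b ∈ ∣ t ∣ ] (a ⊩ p ∣ B) × (b ⊩ q ∣ B) × ¬ ((a ∷ b ∷ []) ⊨ θ)
    found (a ∷ b ∷ [] , h) = a , b , real (λ φ p∋φ → h (inj₁ (φ , p∋φ))) ,
      real (λ ψ q∋ψ → h (inj₂ (inj₁ (ψ , q∋ψ)))) , h (inj₂ (inj₂ tt))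

  -- Descent of orthogonality to `M` and ascent from `M`.

  module _ {M : Params} (smallM : Small κ M) (elementary : ElementarySubmodel M)
           {s t : Sort} {p : GlobalType s} {q : GlobalType t}
           (invp : Invariant M p) (invq : Invariant M q)
           {A : Params} (smallA : Small κ A) (invA : Invariant A p) (stablep : Stable p A) where

    -- Parameters of formulas in p and q proving θ can be found in M, by the
    -- definability of p and q over M.
    union-descends : ∀ {A′ θ} → Small κ A′ → Invariant A′ q → Stable q A′ → θ over M →
                     UnionProves p q θ → UnionProves (p ↾ M) (q ↾ M) θ
    union-descends {A′} {θ} smallA′ invA′ stableq oθ (φs , ψs , p∋φs , q∋ψs , imp) =
      φ′ ⟨ proj₁ pulled ⟩ ∷ [] , ψ′ ⟨ proj₁ pulled ⟩ ∷ [] ,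
      (∋-in p {φ′ ⟨ proj₁ pulled ⟩} (proj₁ (proj₂ (proj₂ pulled))) , proj₁ (proj₂ pulled)) ∷ [] ,
      (∋-in q {ψ′ ⟨ proj₁ pulled ⟩} (proj₁ (proj₂ (proj₂ (proj₂ pulled)))) , proj₁ (proj₂ pulled)) ∷ [] ,
      λ { a b (φa ∷ []) (ψb ∷ []) → proj₂ (proj₂ (proj₂ (proj₂ pulled))) a b φa ψb }
      where
      -- One formula for each type, so that a single tuple `e` holds all parameters to be replaced
      -- and definability is applied once to each type.
      conj : ∀ {u} (χs : List (PFormula [ u ])) → Dfn full [ u ] (λ ρ → All (ρ ⊨_) χs)
      conj χs = dfn-All {X = λ χ ρ → ρ ⊨ χ} (λ χ → dfn-over χ (λ _ → tt)) χs
      module Φ = Dfn (conj φs)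
      module Ψ = Dfn (conj ψs)
      open PFormula Φ.definition renaming (Δ to Γ₁; formula to φ; params to c)
      open PFormula Ψ.definition renaming (Δ to Γ₂; formula to ψ; params to d)
      Γ = Γ₁ ++ Γ₂
      e : Tuple Γ
      e = AllP.++⁺ c d
      φ′ : Formula L (s ∷ Γ)
      φ′ = ren (lift inl) φ
      ψ′ : Formula L (t ∷ Γ)
      ψ′ = ren (lift (inr Γ₁)) ψ
      φ′↔ : ∀ a → Sat φ′ (a ∷ e) ↔ Sat φ (a ∷ c)
      φ′↔ a = Sat-ren (agree-lift (agree-inl c d) a) φ
      ψ′↔ : ∀ b → Sat ψ′ (b ∷ e) ↔ Sat ψ (b ∷ d)
      ψ′↔ b = Sat-ren (agree-lift (agree-inr c d) b) ψ
      -- All that is required of a replacement for `e`. Membership in p and in q is definable over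
      -- `M`, so `Z` is, and it holds at `e`.
      Z : Tuple Γ → Set ℓ
      Z ρ = In p (λ a → Sat φ′ (a ∷ ρ)) × In q (λ b → Sat ψ′ (b ∷ ρ)) ×
            (∀ a b → Sat φ′ (a ∷ ρ) → Sat ψ′ (b ∷ ρ) → (a ∷ b ∷ []) ⊨ θ)
      matrix : Dfn M (t ∷ s ∷ Γ) (λ ρ → Sat φ′ (All.tail ρ) → Sat ψ′ (All.tail (swap ρ)) →
                                        (All.head (All.tail ρ) ∷ All.head ρ ∷ []) ⊨ θ)
      matrix = dfn-⇒ (dfn-weaken (dfn-formula φ′))
        (dfn-⇒ (dfn-swap {X = Sat ψ′ ∘ All.tail} (dfn-weaken (dfn-formula ψ′)))
          (dfn-ren (λ { (here x) → there (here x) ; (there (here x)) → here x ; (there (there ())) })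
            (λ ρ → All.head (All.tail ρ) ∷ All.head ρ ∷ [])
            (λ { (b ∷ a ∷ ρ) → agree λ { (here refl) → refl ; (there (here refl)) → refl } })
            (dfn-over θ oθ)))
      dfn-Z : Dfn M Γ Z
      dfn-Z = dfn-× (definable p A smallA invA stablep smallM invp φ′)
        (dfn-× (definable q A′ smallA′ invA′ stableq smallM invq ψ′)
          (dfn-∀ (dfn-∀ matrix)))
      Ze : Z e
      Ze = in-All p φs p∋φs {X = λ a → Sat φ′ (a ∷ e)}
             (dfn-plug-tail {full} {X = Sat φ′} {b = e} (λ _ → tt) (dfn-formula φ′))
             (λ a φsa → proj₂ (φ′↔ a) (proj₂ (Φ.defines (a ∷ [])) φsa)) ,
           in-All q ψs q∋ψs {X = λ b → Sat ψ′ (b ∷ e)}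
             (dfn-plug-tail {full} {X = Sat ψ′} {b = e} (λ _ → tt) (dfn-formula ψ′))
             (λ b ψsb → proj₂ (ψ′↔ b) (proj₂ (Ψ.defines (b ∷ [])) ψsb)) ,
           λ a b φa ψb → imp a b (proj₁ (Φ.defines (a ∷ [])) (proj₁ (φ′↔ a) φa))
                                 (proj₁ (Ψ.defines (b ∷ [])) (proj₁ (ψ′↔ b) ψb))
      pulled : Σ[ ρ ∈ Tuple Γ ] ρ ∈* M × Z ρ
      pulled = tarskiVaught M elementary dfn-Z (e , Ze)

    module _ (φp : PFormula [ s ]) (φq : PFormula [ t ])
             (p∋φp : Type._∋_ (p ↾ M) φp) (q∋φq : Type._∋_ (q ↾ M) φq)
             {R R′ : Params} (smallR : Small κ R) (smallR′ : Small κ R′)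
             (regularp : Regular p φp R) (regularq : Regular q φq R′)
             (orthogonal : WeaklyOrthogonal (p ↾ M) (q ↾ M)) where

      module _ {N : Params} (smallN : Small κ N) (M⊆N : M ⊆ N) (A⊆N : A ⊆ N)
               (R⊆N : R ⊆ N) (R′⊆N : R′ ⊆ N) where

        -- χ witnesses that the first element does not realise p over the others. The parameters of
        -- χ are kept as variables, so that they can be moved into `M`.
        Dependent : ∀ {Γ} → Formula L (s ∷ t ∷ Γ) → Tuple (s ∷ t ∷ Γ) → Set ℓ
        Dependent χ ρ = Sat χ ρ × ¬ In p (λ x → Sat χ (x ∷ All.tail ρ))

        dfn-Dependent : ∀ {Γ} (χ : Formula L (s ∷ t ∷ Γ)) → Dfn M (s ∷ t ∷ Γ) (Dependent χ)
        dfn-Dependent χ = dfn-× (dfn-formula χ)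
          (dfn-¬ (dfn-weaken (definable p A smallA invA stablep smallM invp χ)))

        -- The condition on `c` that p contain "some y in φq is such that x depends on y through χ
        -- and `c`" is definable over `M` and holds at `c₀`, as `a` and `b` show. So it holds at
        -- some `c` in `M`, and `a`, being generic over `M`, has such a y, of which only φq is
        -- known.
        pull-dependence : ∀ {Γ} (χ : Formula L (s ∷ t ∷ Γ)) (c₀ : Tuple Γ) → c₀ ∈* N →
          ∀ a b → a ⊩ p ∣ N → b ⊩ q ∣ N → Dependent χ (a ∷ b ∷ c₀) →
          Σ[ c ∈ Tuple Γ ] c ∈* M × (Σ[ b′ ∈ ∣ t ∣ ] Dependent χ (a ∷ b′ ∷ c) × (b′ ∷ []) ⊨ φq)
        pull-dependence {Γ} χ c₀ c₀∈N a b ra rb dep =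
          let c , c∈M , E∈p = tarskiVaught M elementary
                (definable-fibres p A smallA invA stablep {X = E} smallM invp dfn-E)
                (c₀ , in-real ra (dfn-plug-tail {X = E} {b = c₀} c₀∈N (dfn-mono M⊆N dfn-E))
                        (b , dep , satisfies rb φq (proj₁ q∋φq , λ i → M⊆N (proj₂ q∋φq i))))
          in c , c∈M , real-in (real-mono M⊆N ra) (dfn-plug-tail {X = E} {b = c} c∈M dfn-E) E∈p
          where
          E : Tuple (s ∷ Γ) → Set ℓ
          E ρ = Σ[ y ∈ ∣ t ∣ ] Dependent χ (swap (y ∷ ρ)) × (y ∷ []) ⊨ φq
          dfn-E : Dfn M (s ∷ Γ) E
          dfn-E = dfn-∃ {X = λ ρ → Dependent χ (swap ρ) × (All.head ρ ∷ []) ⊨ φq}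
            (dfn-× (dfn-swap (dfn-Dependent χ))
              (dfn-ren inl (λ ρ → All.head ρ ∷ []) (λ { (y ∷ ρ) → agree-inl (y ∷ []) ρ })
                (dfn-over φq (proj₂ q∋φq))))

        module _ {Γ : List Sort} (χ : Formula L (s ∷ t ∷ Γ)) (c : Tuple Γ) (c∈M : c ∈* M)
                 (a : ∣ s ∣) (ra : a ⊩ p ∣ N)
                 (b′ : ∣ t ∣) (dep : Dependent χ (a ∷ b′ ∷ c)) (φb′ : (b′ ∷ []) ⊨ φq) where

          private
            W′ : Tuple (s ∷ t ∷ []) → Set ℓ
            W′ ρ = Sat χ (AllP.++⁺ ρ c)

            dfn-W′ : Dfn M (s ∷ t ∷ []) W′
            dfn-W′ = dfn-plug-right {d = c} c∈M (dfn-formula χ)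

            dfn-W′-b′ : Dfn₁ (M ∪ ｛ t , b′ ｝) s (λ x → W′ (x ∷ b′ ∷ []))
            dfn-W′-b′ = dfn-plug-tail {X = W′} {b = b′ ∷ []} (λ { (here refl) → inj₂ refl })
              (dfn-mono inj₁ dfn-W′)

            ¬w′ : In p (λ x → ¬ W′ (x ∷ b′ ∷ []))
            ¬w′ = Sum.[ (λ i → ⊥-elim (proj₂ dep i)) , id ]′ (in-dec p dfn-W′-b′)

          -- Otherwise weak orthogonality would decide dependence through χ and `c` for all pairs of
          -- realisations over `M`. It holds for `a` and `b′`, but fails for `a′` and `b′` when `a′`
          -- realises p over `M` and `b′`.
          b′-not-generic : ¬ (b′ ⊩ q ∣ M)
          b′-not-generic rb′ = Sum.[
              (λ holds → let a′ , ra′ = realiser p (small-∪ smallM (small-single b′)) in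
                ¬real dfn-W′-b′ ¬w′ (proj₁ (holds (real-mono inj₁ ra′) rb′)) ra′) ,
              (λ fails → fails (real-mono M⊆N ra) rb′ dep)
            ]′ (orthogonal-decides {p = p} {q} orthogonal
                 (dfn-plug-right {Γ = s ∷ t ∷ []} {X = Dependent χ} {d = c} c∈M (dfn-Dependent χ)))

          b-independent : ∀ {b} → b ⊩ q ∣ N → b ⊩ q ∣ (N ∪ ｛ t , b′ ｝)
          b-independent rb = regular-adjoin {φ = φq} {p = q} regularq smallN R′⊆N φb′
            (λ r → b′-not-generic (real-mono M⊆N r)) rb

          no-common-dependence : ∀ {b W} → Dfn N (s ∷ t ∷ []) W → b ⊩ q ∣ N → W (a ∷ b ∷ []) →
                                 ¬ In p (λ x → ¬ W (x ∷ b ∷ []))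
          no-common-dependence {b} {W} D rb w ¬w =
            weight-one p A smallA invA stablep φp R regularp q N smallN A⊆N R⊆N
              (inv-mono {A = M} {N} {q} M⊆N invq) (proj₁ p∋φp , λ i → M⊆N (proj₂ p∋φp i))
              {W = W} {W′ = W′} ra (b-independent rb) D w ¬w (dfn-mono M⊆N dfn-W′) (proj₁ dep) ¬w′

        -- If W(a, b, c) witnesses dependence of a and b over N, then definability of p
        -- moves c into M, at the price of replacing b by some b′ that satisfies φq and
        -- depends on a.  By weak orthogonality b′ does not realise q ↾ M, so by
        -- regularity b is independent of b′, against p having weight one.
        no-dependence : ∀ {a b W} → Dfn N (s ∷ t ∷ []) W → a ⊩ p ∣ N → b ⊩ q ∣ N →
                        W (a ∷ b ∷ []) → ¬ In p (λ x → ¬ W (x ∷ b ∷ []))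
        no-dependence {a} {b} {W} D@(dfn (χ ⟨ c₀ ⟩) c₀∈N h) ra rb w ¬w =
          let c , c∈M , b′ , dep , φb′ = pull-dependence χ c₀ c₀∈N a b ra rb
                (proj₂ (h (a ∷ b ∷ [])) w , λ i →
                   in-disjoint p (in-mono {p = p} (λ x → proj₁ (h (x ∷ b ∷ []))) i) ¬w)
          in no-common-dependence χ c c∈M a ra b′ dep φb′ D rb w ¬w

      -- If θ is undecided, there are generic pairs over `N` on which it fails and on which it
      -- holds. Their second components are conjugate over `N`, so by invariance p contains θ at
      -- both or its negation at both, and one of the pairs is dependent.
      orthogonal-lifts : Orthogonal p q
      orthogonal-lifts θ _ with em {P = UnionProves p q θ}
      ... | yes proves = inj₁ proves
      ... | no ¬proves with em {P = UnionProves p q (not θ)}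
      ...   | yes refutes = inj₂ refutes
      ...   | no ¬refutes = ⊥-elim (contradict (in-dec p (dfn-plug-tail {b = b ∷ []} (λ _ → tt)
                (dfn-over {full} θ (λ _ → tt)))))
        where
        c = PFormula.params θ
        N : Params
        N = (((M ∪ A) ∪ R) ∪ R′) ∪ Entries c
        smallN : Small κ N
        smallN = small-∪-entries c (small-∪ (small-∪ (small-∪ smallM smallA) smallR) smallR′)
        c∈N : c ∈* N
        c∈N i = inj₂ (entries {c = c} i)
        counter = union-countermodel {p = p} {q} θ smallN c∈N ¬proves
        counter′ = union-countermodel {p = p} {q} (not θ) smallN c∈N ¬refutes
        b  = proj₁ (proj₂ counter)
        b′ = proj₁ (proj₂ counter′)
        dfn-θ : Dfn N (s ∷ t ∷ []) (_⊨ θ)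
        dfn-θ = dfn-over θ c∈N
        M⊆N : M ⊆ N
        M⊆N i = inj₁ (inj₁ (inj₁ (inj₁ i)))
        no-dep = λ {a b W} → no-dependence {N} smallN M⊆N (λ i → inj₁ (inj₁ (inj₁ (inj₂ i))))
          (λ i → inj₁ (inj₁ (inj₂ i))) (λ i → inj₁ (inj₂ i)) {a} {b} {W}
        contradict : ¬ (In p (λ x → (x ∷ b ∷ []) ⊨ θ) ⊎ In p (λ x → ¬ ((x ∷ b ∷ []) ⊨ θ)))
        contradict (inj₁ θ∈p) =
          let a , _ , ra , rb , ¬θ = counter in
          no-dep (dfn-¬ dfn-θ) ra rb ¬θ (in-mono {p = p} (λ x θx ¬θx → ¬θx θx) θ∈p)
        contradict (inj₂ ¬θ∈p) =
          let _ , _ , _ , rb , _ = counter ; a , _ , ra , rb′ , ¬¬θ = counter′ in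
          no-dep dfn-θ ra rb′ (byContradiction λ ¬θ → ¬¬θ (λ θab → ⊥-elim (¬θ θab)))
            (inv-in {X = λ ρ → ¬ (ρ ⊨ θ)} {p = p} (inv-mono {A = M} {N} {p} M⊆N invp)
              (eq-realisers id (λ ()) rb rb′) (dfn-¬ dfn-θ) ¬θ∈p)

-- Equivalence of the three conditions.

theorem3 : (∀ {a} → ExcludedMiddle a) →
    ∀ {ℓ} (L : Language ℓ) (T : Theory L) → CompleteTheory T →
    (κ : Cardinal ℓ) (M̄ : Structure L) → Models M̄ T →
    let open InStructure M̄ in
    IsMonster κ →
    (M : Params) → Small κ M → ElementarySubmodel M →
    ∀ {s t} (p : GlobalType s) (φp : PFormula [ s ]) (q : GlobalType t) (φq : PFormula [ t ]) →
    InvariantPair M p φp → InvariantPair M q φq →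
    StronglyRegular κ p φp → StronglyRegular κ q φq →
    GenericallyStable κ p → GenericallyStable κ q →
    (Orthogonal p q ⇔ WeaklyOrthogonal (p ↾ M) (q ↾ M)) ×
    (WeaklyOrthogonal (p ↾ M) (q ↾ M) ⇔
    (Σ[ C ∈ Params ] Small κ C × M ⊆ C × WeaklyOrthogonal (p ↾ C) (q ↾ C)))
theorem3 em L T _ κ M̄ _ monster M smallM elementary p φp q φq (invp , p∋φp) (invq , q∋φq)
  (R , smallR , _ , regularp) (R′ , smallR′ , _ , regularq)
  (_ , A , smallA , invA , stablep) (_ , A′ , smallA′ , invA′ , stableq) =
  mk⇔ restricts
      (orthogonal-lifts {M} smallM elementary {p = p} {q} invp invq {A} smallA invA stablep
        φp φq p∋φp q∋φq {R} {R′} smallR smallR′ regularp regularq) ,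
  mk⇔ (λ orth → M , smallM , (λ {_} i → i) , orth)
      (λ (C , _ , M⊆C , orth) → restricts-from C (λ {e} → M⊆C {e}) orth)
  where
  open InStructure M̄
  open StrongRegularity em M̄ κ monster
  descend : ∀ θ → θ over M → UnionProves p q θ → UnionProves (p ↾ M) (q ↾ M) θ
  descend θ o = union-descends {M} smallM elementary {p = p} {q} invp invq {A} smallA invA stablep
    {A′} {θ} smallA′ invA′ stableq o
  -- A proof from the restrictions to `C` is one from the global types, so condition (3) descends to
  -- `M` by the same argument as condition (1).
  globalise : ∀ C {θ} → UnionProves (p ↾ C) (q ↾ C) θ → UnionProves p q θ
  globalise C (φs , ψs , p∋φs , q∋ψs , imp) =
    φs , ψs , All.map proj₁ p∋φs , All.map proj₁ q∋ψs , imp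
  restricts : Orthogonal p q → WeaklyOrthogonal (p ↾ M) (q ↾ M)
  restricts orth θ o = Sum.map (descend θ o) (descend (not θ) o) (orth θ (λ _ → tt))
  restricts-from : ∀ C → M ⊆ C → WeaklyOrthogonal (p ↾ C) (q ↾ C) →
                   WeaklyOrthogonal (p ↾ M) (q ↾ M)
  restricts-from C M⊆C orth θ o = Sum.map (descend θ o ∘ globalise C {θ})
    (descend (not θ) o ∘ globalise C {not θ}) (orth θ (λ i → M⊆C (o i)))
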